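{- Let $k\ge2$ and let $\mathcal{G}$ and $\mathcal{F}$ be $k$-uniform hypergraphs such that there is no homomorphism from $\mathcal{G}$ to $\mathcal{F}$. Then $$\frac{n^k}{v(\mathcal{F})^k}+o(n^k)\le ex_{\mathcal{F}}(n,\mathcal{G})\le e(\mathcal{F})^{ -1}ex_k(n,\mathcal{G})+o(n^k).$$ Moreover, if $\chi(\mathcal{F})=k$, then $ex_{\mathcal{F}}(n,\mathcal{G})=e(\mathcal{F})^{ -1}ex_k(n,\mathcal{G})+o(n^k)$.
   Context: For $k$-uniform hypergraphs $\mathcal{F}$ and $\mathcal{G}$, consider $n$-vertex $k$-uniform hypergraphs $\mathcal{R}$ whose edge set is the union of pairwise edge-disjoint subhypergraphs each isomorphic to $\mathcal{F}$ (called $\mathcal{F}$-copies; each is thought of as a single colour). A subhypergraph of $\mathcal{R}$ is rainbow if its edges come from pairwise distinct $\mathcal{F}$-copies. $ex_{\mathcal{F}}(n,\mathcal{G})$ is the maximum number of $\mathcal{F}$-copies in such an $n$-vertex $\mathcal{R}$ with no rainbow copy of $\mathcal{G}$. $ex_k(n,\mathcal{G})$ is the Turán number: the maximum number of edges of an $n$-vertex $k$-uniform hypergraph containing no copy of $\mathcal{G}$. $v(\cdot)$ and $e(\cdot)$ denote numbers of vertices and edges. A homomorphism from $\mathcal{G}$ to $\mathcal{F}$ is a map $\varphi:V(\mathcal{G})\to V(\mathcal{F})$ with $\varphi(e)\in E(\mathcal{F})$ for every $e\in E(\mathcal{G})$. The condition $\chi(\mathcal{F})=k$ is used in the paper to mean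 that $\mathcal{F}$ is $k$-partite: $V(\mathcal{F})$ can be partitioned into $k$ classes such that every edge has exactly one vertex in each class. -}

module Defs where

open import Data.Nat using (ℕ; zero; suc; _+_; _*_; _^_; _≤_)
open import Data.Bool using (Bool; true; false)
open import Data.Vec using (Vec; []; _∷_)
open import Data.Fin using (Fin; zero; suc)
open import Data.Fin.Subset using (Subset; ⁅_⁆; _∪_; ∣_∣; _∈_) renaming (⊥ to ∅)
open import Data.List using (List; length; lookup)
open import Data.List.Relation.Unary.All using (All)
open import Data.List.Relation.Unary.Unique.Propositional using (Unique)
import Data.List.Membership.Propositional as LM
open import Data.Product using (Σ; ∃; ∃-syntax; _×_)
open import Function using (_∘_)
open import Function.Definitions using (Injective)
open import Relation.Binary.PropositionalEquality using (_≡_; _≢_)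
open import Relation.Nullary using (¬_)

record Hypergraph (k v : ℕ) : Set where
  field
    edges    : List (Subset v)
    uniform  : All (λ e → ∣ e ∣ ≡ k) edges
    distinct : Unique edges
open Hypergraph public

e : ∀ {k v} → Hypergraph k v → ℕ
e H = length (edges H)

img : ∀ {m n} → (Fin m → Fin n) → Subset m → Subset n
img {zero}  φ []          = ∅
img {suc m} φ (true ∷ s)  = ⁅ φ zero ⁆ ∪ img (φ ∘ suc) s
img {suc m} φ (false ∷ s) = img (φ ∘ suc) s

Hom : ∀ {k vG vF} → Hypergraph k vG → Hypergraph k vF → Set
Hom {vG = vG} {vF} G F =
  Σ (Fin vG → Fin vF) λ φ → All (λ s → img φ s LM.∈ edges F) (edges G)

Copy : ∀ {k vG n} → Hypergraph k vG → Hypergraph k n → Set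
Copy {vG = vG} {n} G H =
  Σ (Fin vG → Fin n) λ φ → Injective _≡_ _≡_ φ × All (λ s → img φ s LM.∈ edges H) (edges G)

-- An n-vertex hypergraph R whose edge set is the union of pairwise
-- edge-disjoint F-copies; the copies are indexed by Fin count.
record Packing {k vF : ℕ} (F : Hypergraph k vF) (n : ℕ) : Set where
  field
    count    : ℕ
    copy     : Fin count → (Fin vF → Fin n)
    copyInj  : ∀ i → Injective _≡_ _≡_ (copy i)
    disjoint : ∀ (i j : Fin count) → i ≢ j → ∀ {s t} → s LM.∈ edges F → t LM.∈ edges F →
               img (copy i) s ≢ img (copy j) t
open Packing public

record Rainbow {k vF vG n : ℕ} {F : Hypergraph k vF} (G : Hypergraph k vG) (R : Packing F n) : Set where
  field
    ψ      : Fin vG → Fin n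
    ψInj   : Injective _≡_ _≡_ ψ
    col    : Fin (e G) → Fin (count R)
    colInj : Injective _≡_ _≡_ col
    fits   : ∀ i → ∃[ t ] (t LM.∈ edges F × img ψ (lookup (edges G) i) ≡ img (copy R (col i)) t)

IsMax : (ℕ → Set) → ℕ → Set
IsMax P m = P m × (∀ x → P x → x ≤ m)

IsExF : ∀ {k vF vG} → Hypergraph k vF → Hypergraph k vG → ℕ → ℕ → Set
IsExF F G n = IsMax (λ t → Σ (Packing F n) λ R → count R ≡ t × ¬ Rainbow G R)

IsExK : ∀ {k vG} → Hypergraph k vG → ℕ → ℕ → Set
IsExK {k} G n = IsMax (λ m → Σ (Hypergraph k n) λ H → e H ≡ m × ¬ Copy G H)

KPartite : ∀ {k vF} → Hypergraph k vF → Set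
KPartite {k} {vF} F =
  Σ (Fin vF → Fin k) λ c → All (λ s → ∀ (j : Fin k) →
      (∃[ x ] (x ∈ s × c x ≡ j)) ×
      (∀ x y → x ∈ s → y ∈ s → c x ≡ j → c y ≡ j → x ≡ y)) (edges F)

Eventually : (ℕ → Set) → Set
Eventually P = ∃[ N ] (∀ n → N ≤ n → P n)

{-# OPTIONS --safe #-}
module Submission where

-- Lower bound. Take the F-copies to be the graphs of the polynomials of degree < k over ℤ/m, on the
-- vertex set V(F) × ℤ/m with m ≡ 1 modulo v(F)!. Differences of points of V(F) are invertible modulo m,
-- so two graphs share fewer than k vertices, and the m^k copies are edge-disjoint. The projection to V(F)
-- turns a rainbow copy of G into a homomorphism from G to F.
--
-- Upper bound. In a packing without rainbow G all but O(n^(v(G) − 1)) maps V(G) → [n] fail to be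
-- homomorphisms into the union R: in a homomorphism, which is not injective or has two edges in the same
-- F-copy, one vertex is determined, up to O(1) choices, by the others.
-- By Cauchy–Schwarz, giving the vertices of G private coordinates one at a time, the homomorphisms
-- that factor through a fixed φ : V(G) → [M] have vanishing density as well. So, for a random z ∈ [n]^M,
-- the hypergraph induced by R on z is usually free of homomorphic images of G; blown up to n vertices it is
-- G-free, and it has e(R) − O(n^k / M) edges on average.
--
-- If F is k-partite, the same use of Cauchy–Schwarz with φ the colouring V(F) → [k] shows that an F-free
-- hypergraph has o(n^k) edges, so that copies of F can be removed greedily from an extremal G-free
-- hypergraph until only o(n^k) edges are left.

open import Defs

open import Data.Bool using (true; false; if_then_else_)
open import Data.Bool.Properties using () renaming (_≟_ to _≟ᵇ_)
open import Data.Empty using (⊥-elim)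
open import Data.Fin using (Fin; zero; suc; toℕ; fromℕ<; _↑ˡ_; _↑ʳ_; combine; inject≤; finToFun; funToFin)
open import Data.Fin.Properties using
  ( any?; toℕ<n; toℕ-injective; toℕ-fromℕ<; ↑ˡ-injective; ↑ʳ-injective; toℕ-↑ˡ; toℕ-↑ʳ
  ; combine-injective; inject≤-injective; funToFin-finToFin)
  renaming (_≟_ to _≟ᶠ_; suc-injective to sucᶠ-injective)
open import Data.Fin.Subset using (Subset; ⁅_⁆; _∪_; ∣_∣; _∈_; _∉_; _⊆_; _-_; ⊤)
open import Data.Fin.Subset.Properties
open import Data.Integer as ℤ using (ℤ; 0ℤ)
import Data.Integer.DivMod as ℤ-DivMod
open import Data.Integer.Divisibility.Signed using (divides; ∣ᵤ⇒∣; ∣⇒∣ᵤ; ∣m∣n⇒∣m-n; ∣n⇒∣m*n; ∣m⇒∣m*n)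
  renaming (_∣_ to _∣ℤ_)
import Data.Integer.Properties as ℤₚ
open import Data.Integer.Tactic.RingSolver using () renaming (solve-∀ to solveℤ-∀)
open import Data.List as List using
  (List; []; _∷_; _++_; map; length; filter; upTo; allFin; cartesianProduct; cartesianProductWith)
import Data.List.Membership.DecPropositional as DecMembership
import Data.List.Membership.Propositional as LM
open import Data.List.Membership.Propositional.Properties using
  ( ∈-map⁺; ∈-map⁻; ∈-++⁺ˡ; ∈-++⁺ʳ; ∈-filter⁻; ∈-lookup; ∈-allFin; ∈-upTo⁺
  ; ∈-cartesianProductWith⁺; ∈-cartesianProduct⁺; ∈-cartesianProduct⁻)
import Data.List.Properties as LP
open import Data.List.Relation.Unary.All as All using (All; []; _∷_)
import Data.List.Relation.Unary.All.Properties as Allₚ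
open import Data.List.Relation.Unary.AllPairs using ([]; _∷_)
open import Data.List.Relation.Unary.Any as Any using (here; there)
import Data.List.Relation.Unary.Any.Properties as Anyₚ
open import Data.List.Relation.Unary.Unique.Propositional using (Unique)
import Data.List.Relation.Unary.Unique.Propositional.Properties as Uniqueₚ
open import Data.Nat
open import Data.Nat.Divisibility as ∣ using ()
open import Data.Nat.DivMod using (m≡m%n+[m/n]*n; m%n<n; m/n*n≤m; m<n*o⇒m/o<n)
open import Data.Nat.Properties
open import Data.Nat.Tactic.RingSolver using (solve-∀)
open import Data.Product using (_×_; _,_; ∃; ∃-syntax; proj₁; proj₂)
open import Data.Sum using (_⊎_; inj₁; inj₂)
open import Data.Vec as Vec using (Vec; []; _∷_; lookup; _[_]≔_; here; there)
open import Data.Vec.Properties using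
  ( ≡-dec; ∷-injective; map-∘; lookup-map; lookup-zipWith; lookup∘tabulate; tabulate∘lookup; tabulate-cong
  ; lookup∘update; lookup∘update′)
open import Function using (_∘_; id)
open import Function.Definitions using (Injective)
open import Relation.Binary.Definitions using (DecidableEquality)
open import Relation.Binary.PropositionalEquality
open import Relation.Nullary using (¬_; Dec; yes; no; does)
open import Relation.Nullary.Decidable using (_×-dec_; ¬?; map′)
open import Relation.Unary using (Decidable)

-- Finite sums

private
  variable
    A B : Set

∑ : List A → (A → ℕ) → ℕ
∑ []       f = 0
∑ (x ∷ xs) f = f x + ∑ xs f

∑-mono : ∀ (xs : List A) {f g : A → ℕ} → (∀ x → f x ≤ g x) → ∑ xs f ≤ ∑ xs g
∑-mono []       f≤g = z≤n
∑-mono (x ∷ xs) f≤g = +-mono-≤ (f≤g x) (∑-mono xs f≤g)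

∑-cong : ∀ (xs : List A) {f g : A → ℕ} → (∀ x → f x ≡ g x) → ∑ xs f ≡ ∑ xs g
∑-cong []       f≡g = refl
∑-cong (x ∷ xs) f≡g = cong₂ _+_ (f≡g x) (∑-cong xs f≡g)

+-exchange : ∀ a b c d → (a + b) + (c + d) ≡ (a + c) + (b + d)
+-exchange = solve-∀

∑-+ : ∀ (xs : List A) (f g : A → ℕ) → ∑ xs (λ x → f x + g x) ≡ ∑ xs f + ∑ xs g
∑-+ []       f g = refl
∑-+ (x ∷ xs) f g = trans (cong (f x + g x +_) (∑-+ xs f g)) (+-exchange (f x) (g x) _ _)

∑-*ˡ : ∀ (xs : List A) c (f : A → ℕ) → ∑ xs (λ x → c * f x) ≡ c * ∑ xs f
∑-*ˡ []       c f = sym (*-zeroʳ c)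
∑-*ˡ (x ∷ xs) c f = trans (cong (c * f x +_) (∑-*ˡ xs c f)) (sym (*-distribˡ-+ c (f x) _))

∑-*ʳ : ∀ (xs : List A) c (f : A → ℕ) → ∑ xs (λ x → f x * c) ≡ ∑ xs f * c
∑-*ʳ xs c f = trans (∑-cong xs (λ x → *-comm (f x) c)) (trans (∑-*ˡ xs c f) (*-comm c _))

∑-const : ∀ (xs : List A) c → ∑ xs (λ _ → c) ≡ length xs * c
∑-const []       c = refl
∑-const (x ∷ xs) c = cong (c +_) (∑-const xs c)

∑-bound : ∀ (xs : List A) {f : A → ℕ} {c} → (∀ x → f x ≤ c) → ∑ xs f ≤ length xs * c
∑-bound xs {c = c} f≤c = ≤-trans (∑-mono xs f≤c) (≤-reflexive (∑-const xs c))

∑-swap : ∀ (xs : List A) (ys : List B) (f : A → B → ℕ) →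
         ∑ xs (λ x → ∑ ys (f x)) ≡ ∑ ys (λ y → ∑ xs (λ x → f x y))
∑-swap []       ys f = sym (trans (∑-const ys 0) (*-zeroʳ (length ys)))
∑-swap (x ∷ xs) ys f = trans (cong (∑ ys (f x) +_) (∑-swap xs ys f)) (sym (∑-+ ys (f x) _))

∑-++ : ∀ (xs ys : List A) (f : A → ℕ) → ∑ (xs ++ ys) f ≡ ∑ xs f + ∑ ys f
∑-++ []       ys f = refl
∑-++ (x ∷ xs) ys f = trans (cong (f x +_) (∑-++ xs ys f)) (sym (+-assoc (f x) _ _))

∑-map : ∀ (g : A → B) (xs : List A) (f : B → ℕ) → ∑ (map g xs) f ≡ ∑ xs (f ∘ g)
∑-map g []       f = refl
∑-map g (x ∷ xs) f = cong (f (g x) +_) (∑-map g xs f)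

∑-member : ∀ {xs : List A} {x} (f : A → ℕ) → x LM.∈ xs → f x ≤ ∑ xs f
∑-member f (here refl) = m≤m+n _ _
∑-member f (there x∈)  = ≤-trans (∑-member f x∈) (m≤n+m _ _)

∑-cartesian : ∀ {C : Set} (_⊗_ : A → B → C) (xs : List A) (ys : List B) (f : C → ℕ) →
  ∑ (cartesianProductWith _⊗_ xs ys) f ≡ ∑ xs (λ x → ∑ ys (λ y → f (x ⊗ y)))
∑-cartesian _⊗_ []       ys f = refl
∑-cartesian _⊗_ (x ∷ xs) ys f =
  trans (∑-++ (map (x ⊗_) ys) _ f) (cong₂ _+_ (∑-map (x ⊗_) ys f) (∑-cartesian _⊗_ xs ys f))

2ab≤a²+b² : ∀ a b → 2 * (a * b) ≤ a * a + b * b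
2ab≤a²+b² zero    b       = z≤n
2ab≤a²+b² (suc a) zero    = ≤-trans (≤-reflexive (cong (2 *_) (*-zeroʳ (suc a)))) z≤n
2ab≤a²+b² (suc a) (suc b) = subst₂ _≤_ (lhs a b) (rhs a b) (+-monoˡ-≤ (2 * a + 2 * b + 2) (2ab≤a²+b² a b))
  where
  lhs : ∀ a b → 2 * (a * b) + (2 * a + 2 * b + 2) ≡ 2 * (suc a * suc b)
  lhs = solve-∀
  rhs : ∀ a b → a * a + b * b + (2 * a + 2 * b + 2) ≡ suc a * suc a + suc b * suc b
  rhs = solve-∀

-- By induction on the list: the mixed term in the square of `a + S` is bounded term by term, using
-- that 2ab is at most a² + b².
cauchy-schwarz : ∀ (xs : List A) (f : A → ℕ) → ∑ xs f * ∑ xs f ≤ length xs * ∑ xs (λ x → f x * f x)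
cauchy-schwarz []       f = z≤n
cauchy-schwarz (x ∷ xs) f = begin
  (a + S) * (a + S)                     ≡⟨ expand a S ⟩
  a * a + (2 * (a * S) + S * S)         ≤⟨ +-monoʳ-≤ (a * a) (+-mono-≤ cross (cauchy-schwarz xs f)) ⟩
  a * a + (l * (a * a) + Q + l * Q)     ≡⟨ collect a l Q ⟩
  suc l * (a * a + Q)                   ∎
  where
  open ≤-Reasoning
  a = f x
  S = ∑ xs f
  Q = ∑ xs (λ y → f y * f y)
  l = length xs
  expand : ∀ a S → (a + S) * (a + S) ≡ a * a + (2 * (a * S) + S * S)
  expand = solve-∀
  collect : ∀ a l Q → a * a + (l * (a * a) + Q + l * Q) ≡ suc l * (a * a + Q)
  collect = solve-∀
  cross : 2 * (a * S) ≤ l * (a * a) + Q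
  cross = begin
    2 * (a * S)                          ≡⟨ sym (trans (∑-*ˡ xs 2 (λ y → a * f y)) (cong (2 *_) (∑-*ˡ xs a f))) ⟩
    ∑ xs (λ y → 2 * (a * f y))           ≤⟨ ∑-mono xs (λ y → 2ab≤a²+b² a (f y)) ⟩
    ∑ xs (λ y → a * a + f y * f y)       ≡⟨ trans (∑-+ xs (λ _ → a * a) _) (cong (_+ Q) (∑-const xs (a * a))) ⟩
    l * (a * a) + Q                      ∎

-- Indicators of decidable propositions

𝟙 : {P : Set} → Dec P → ℕ
𝟙 d = if does d then 1 else 0

𝟙-yes : ∀ {P : Set} (d : Dec P) → P → 𝟙 d ≡ 1
𝟙-yes (yes _) p = refl
𝟙-yes (no ¬p) p = ⊥-elim (¬p p)

𝟙-no : ∀ {P : Set} (d : Dec P) → ¬ P → 𝟙 d ≡ 0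
𝟙-no (yes p) ¬p = ⊥-elim (¬p p)
𝟙-no (no _)  _  = refl

𝟙≤1 : ∀ {P : Set} (d : Dec P) → 𝟙 d ≤ 1
𝟙≤1 (yes _) = ≤-refl
𝟙≤1 (no _)  = z≤n

𝟙-elim : ∀ {P : Set} (d : Dec P) {m} → (P → 1 ≤ m) → 𝟙 d ≤ m
𝟙-elim (yes p) f = f p
𝟙-elim (no _)  f = z≤n

𝟙-mono : ∀ {P Q : Set} (d : Dec P) (d′ : Dec Q) → (P → Q) → 𝟙 d ≤ 𝟙 d′
𝟙-mono d d′ f = 𝟙-elim d (λ p → ≤-reflexive (sym (𝟙-yes d′ (f p))))

𝟙-cong : ∀ {P Q : Set} (d : Dec P) (d′ : Dec Q) → (P → Q) → (Q → P) → 𝟙 d ≡ 𝟙 d′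
𝟙-cong d d′ f g = ≤-antisym (𝟙-mono d d′ f) (𝟙-mono d′ d g)

𝟙-pairwise : ∀ {P Q R : Set} (p : Dec P) (q : Dec Q) (r : Dec R) → (P → Q → R) → 𝟙 p * 𝟙 q ≤ 𝟙 r
𝟙-pairwise (no _)  q r f = z≤n
𝟙-pairwise (yes p) q r f = ≤-trans (≤-reflexive (+-identityʳ (𝟙 q))) (𝟙-mono q r (f p))

∑-𝟙-filter : ∀ {P : A → Set} (P? : Decidable P) (xs : List A) → ∑ xs (λ x → 𝟙 (P? x)) ≡ length (filter P? xs)
∑-𝟙-filter P? []       = refl
∑-𝟙-filter P? (x ∷ xs) with P? x
... | yes _ = cong suc (∑-𝟙-filter P? xs)
... | no _  = ∑-𝟙-filter P? xs

∑-disjoint≤1 : ∀ {P : A → Set} (P? : Decidable P) {xs : List A} → Unique xs →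
  (∀ {x y} → P x → P y → x ≡ y) → ∑ xs (λ x → 𝟙 (P? x)) ≤ 1
∑-disjoint≤1 P? [] P-unique = z≤n
∑-disjoint≤1 {P = P} P? {x ∷ xs} (x∉xs ∷ u) P-unique with P? x
... | no _  = ∑-disjoint≤1 P? u P-unique
... | yes p = s≤s (≤-reflexive (vanish x∉xs))
  where
  vanish : ∀ {ys} → All (x ≢_) ys → ∑ ys (λ y → 𝟙 (P? y)) ≡ 0
  vanish []             = refl
  vanish {y ∷ _} (x≢y ∷ rest) =
    cong₂ _+_ (𝟙-no (P? y) (λ q → x≢y (P-unique p q))) (vanish rest)

-- Uniformly sampled vectors

module _ (n : ℕ) where

  vecs : ∀ D → List (Vec (Fin n) D)
  vecs zero    = [] ∷ []
  vecs (suc D) = cartesianProductWith _∷_ (allFin n) (vecs D)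

module _ {n : ℕ} where

  ∑-vecs-suc : ∀ D (f : Vec (Fin n) (suc D) → ℕ) →
    ∑ (vecs n (suc D)) f ≡ ∑ (allFin n) (λ x → ∑ (vecs n D) (λ z → f (x ∷ z)))
  ∑-vecs-suc D f = ∑-cartesian _∷_ (allFin n) (vecs n D) f

  length-allFin : length (allFin n) ≡ n
  length-allFin = LP.length-tabulate {n = n} (λ i → i)

  length-vecs : ∀ D → length (vecs n D) ≡ n ^ D
  length-vecs zero    = refl
  length-vecs (suc D) = begin
    length (vecs n (suc D))                      ≡⟨ sym (trans (∑-const (vecs n (suc D)) 1) (*-identityʳ _)) ⟩
    ∑ (vecs n (suc D)) (λ _ → 1)                 ≡⟨ ∑-vecs-suc D (λ _ → 1) ⟩
    ∑ (allFin n) (λ _ → ∑ (vecs n D) (λ _ → 1))  ≡⟨ ∑-const (allFin n) _ ⟩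
    length (allFin n) * ∑ (vecs n D) (λ _ → 1)   ≡⟨ cong₂ _*_ length-allFin (trans (∑-const (vecs n D) 1) (trans (*-identityʳ _) (length-vecs D))) ⟩
    n * n ^ D ∎
    where open ≡-Reasoning

  ∑-vecs-const : ∀ D c → ∑ (vecs n D) (λ _ → c) ≡ n ^ D * c
  ∑-vecs-const D c = trans (∑-const (vecs n D) c) (cong (_* c) (length-vecs D))

  -- Overwriting one coordinate of a uniform vector by a uniform value leaves it uniform: every
  -- vector arises `n` times, once for each value of the forgotten entry. This replaces conditioning
  -- on all coordinates but one.
  resample : ∀ {D} (w : Fin D) (g : Vec (Fin n) D → ℕ) →
    ∑ (vecs n D) (λ z → ∑ (allFin n) (λ x → g (z [ w ]≔ x))) ≡ n * ∑ (vecs n D) g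
  resample {suc D} zero g = begin
    ∑ (vecs n (suc D)) (λ z → ∑ (allFin n) (λ x → g (z [ zero ]≔ x)))
      ≡⟨ ∑-vecs-suc D _ ⟩
    ∑ (allFin n) (λ _ → ∑ (vecs n D) (λ z → ∑ (allFin n) (λ x → g (x ∷ z))))
      ≡⟨ ∑-const (allFin n) _ ⟩
    length (allFin n) * ∑ (vecs n D) (λ z → ∑ (allFin n) (λ x → g (x ∷ z)))
      ≡⟨ cong₂ _*_ length-allFin (trans (∑-swap (vecs n D) (allFin n) _) (sym (∑-vecs-suc D g))) ⟩
    n * ∑ (vecs n (suc D)) g ∎
    where open ≡-Reasoning
  resample {suc D} (suc w) g = begin
    ∑ (vecs n (suc D)) (λ z → ∑ (allFin n) (λ x → g (z [ suc w ]≔ x)))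
      ≡⟨ ∑-vecs-suc D _ ⟩
    ∑ (allFin n) (λ y → ∑ (vecs n D) (λ z → ∑ (allFin n) (λ x → g (y ∷ (z [ w ]≔ x)))))
      ≡⟨ ∑-cong (allFin n) (λ y → resample w (λ z → g (y ∷ z))) ⟩
    ∑ (allFin n) (λ y → n * ∑ (vecs n D) (λ z → g (y ∷ z)))
      ≡⟨ trans (∑-*ˡ (allFin n) n _) (cong (n *_) (sym (∑-vecs-suc D g))) ⟩
    n * ∑ (vecs n (suc D)) g ∎
    where open ≡-Reasoning

  -- Union bound over the labels, resampling for each label one coordinate.
  count-covered : ∀ {D} {L : Set} (labels : List L) (c : ℕ) (coord : L → Fin D)
    {P : Vec (Fin n) D → Set} (P? : Decidable P)
    {Q : L → Vec (Fin n) D → Set} (Q? : ∀ l → Decidable (Q l)) →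
    (∀ z → P z → ∃ λ l → l LM.∈ labels × Q l z) →
    (∀ l z → ∑ (allFin n) (λ x → 𝟙 (Q? l (z [ coord l ]≔ x))) ≤ c) →
    n * ∑ (vecs n D) (λ z → 𝟙 (P? z)) ≤ length labels * c * n ^ D
  count-covered {D} labels c coord P? Q? cover few = begin
    n * ∑ (vecs n D) (λ z → 𝟙 (P? z))
      ≤⟨ *-monoʳ-≤ n (∑-mono (vecs n D) (λ z → 𝟙-elim (P? z) (λ p → atLeastOne z (cover z p)))) ⟩
    n * ∑ (vecs n D) (λ z → ∑ labels (λ l → 𝟙 (Q? l z)))
      ≡⟨ cong (n *_) (∑-swap (vecs n D) labels _) ⟩
    n * ∑ labels (λ l → ∑ (vecs n D) (λ z → 𝟙 (Q? l z)))
      ≡⟨ sym (∑-*ˡ labels n _) ⟩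
    ∑ labels (λ l → n * ∑ (vecs n D) (λ z → 𝟙 (Q? l z)))
      ≤⟨ ∑-bound labels perLabel ⟩
    length labels * (n ^ D * c)
      ≡⟨ rearrange (length labels) (n ^ D) c ⟩
    length labels * c * n ^ D ∎
    where
    open ≤-Reasoning
    rearrange : ∀ a b c → a * (b * c) ≡ a * c * b
    rearrange = solve-∀
    atLeastOne : ∀ z → (∃ λ l → l LM.∈ labels × _) → 1 ≤ ∑ labels (λ l → 𝟙 (Q? l z))
    atLeastOne z (l , l∈ , q) =
      ≤-trans (≤-reflexive (sym (𝟙-yes (Q? l z) q))) (∑-member (λ l → 𝟙 (Q? l z)) l∈)
    perLabel : ∀ l → n * ∑ (vecs n D) (λ z → 𝟙 (Q? l z)) ≤ n ^ D * c
    perLabel l = begin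
      n * ∑ (vecs n D) (λ z → 𝟙 (Q? l z))                                    ≡⟨ sym (resample (coord l) _) ⟩
      ∑ (vecs n D) (λ z → ∑ (allFin n) (λ x → 𝟙 (Q? l (z [ coord l ]≔ x))))  ≤⟨ ∑-mono (vecs n D) (few l) ⟩
      ∑ (vecs n D) (λ _ → c)                                                 ≡⟨ ∑-vecs-const D c ⟩
      n ^ D * c ∎

-- Images of subsets

_≟ˢ_ : ∀ {n} → DecidableEquality (Subset n)
_≟ˢ_ = ≡-dec _≟ᵇ_

_≟ᵛ_ : ∀ {n k} → DecidableEquality (Vec (Fin n) k)
_≟ᵛ_ = ≡-dec _≟ᶠ_

module _ {n : ℕ} where
  open DecMembership (_≟ˢ_ {n}) public using () renaming (_∈?_ to _∈ˢ?_)

module _ {n k : ℕ} where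
  open DecMembership (_≟ᵛ_ {n} {k}) public using () renaming (_∈?_ to _∈ᵛ?_)

∈-vecs : ∀ {n D} (z : Vec (Fin n) D) → z LM.∈ vecs n D
∈-vecs []      = here refl
∈-vecs (x ∷ z) = ∈-cartesianProductWith⁺ _∷_ (∈-allFin x) (∈-vecs z)

∈-img⁺ : ∀ {m n} (φ : Fin m → Fin n) {s x} → x ∈ s → φ x ∈ img φ s
∈-img⁺ φ {true ∷ s}  here       = p⊆p∪q (img (φ ∘ suc) s) (x∈⁅x⁆ (φ zero))
∈-img⁺ φ {true ∷ s}  (there x∈) = q⊆p∪q ⁅ φ zero ⁆ (img (φ ∘ suc) s) (∈-img⁺ (φ ∘ suc) x∈)
∈-img⁺ φ {false ∷ s} (there x∈) = ∈-img⁺ (φ ∘ suc) x∈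

∈-img⁻ : ∀ {m n} (φ : Fin m → Fin n) s {y} → y ∈ img φ s → ∃[ x ] (x ∈ s × y ≡ φ x)
∈-img⁻ φ []          y∈ = ⊥-elim (∉⊥ y∈)
∈-img⁻ φ (true ∷ s)  y∈ with x∈p∪q⁻ ⁅ φ zero ⁆ (img (φ ∘ suc) s) y∈
... | inj₁ y∈₀ = zero , here , x∈⁅y⁆⇒x≡y (φ zero) y∈₀
... | inj₂ y∈₁ with ∈-img⁻ (φ ∘ suc) s y∈₁
...   | x , x∈ , eq = suc x , there x∈ , eq
∈-img⁻ φ (false ∷ s) y∈ with ∈-img⁻ (φ ∘ suc) s y∈
... | x , x∈ , eq = suc x , there x∈ , eq

img-cong : ∀ {m n} {φ ψ : Fin m → Fin n} s → (∀ {x} → x ∈ s → φ x ≡ ψ x) → img φ s ≡ img ψ s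
img-cong []          eq = refl
img-cong (true ∷ s)  eq = cong₂ (λ a b → ⁅ a ⁆ ∪ b) (eq here) (img-cong s (eq ∘ there))
img-cong (false ∷ s) eq = img-cong s (eq ∘ there)

img-∘ : ∀ {l m n} (φ : Fin m → Fin n) (ψ : Fin l → Fin m) s → img φ (img ψ s) ≡ img (φ ∘ ψ) s
img-∘ φ ψ s = ⊆-antisym to from
  where
  to : img φ (img ψ s) ⊆ img (φ ∘ ψ) s
  to y∈ with ∈-img⁻ φ (img ψ s) y∈
  ... | x , x∈ , refl with ∈-img⁻ ψ s x∈
  ...   | w , w∈ , refl = ∈-img⁺ (φ ∘ ψ) w∈
  from : img (φ ∘ ψ) s ⊆ img φ (img ψ s)
  from y∈ with ∈-img⁻ (φ ∘ ψ) s y∈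
  ... | w , w∈ , refl = ∈-img⁺ φ (∈-img⁺ ψ w∈)

img-id : ∀ {n} (s : Subset n) → img id s ≡ s
img-id s = ⊆-antisym to (∈-img⁺ id)
  where
  to : img id s ⊆ s
  to y∈ with ∈-img⁻ id s y∈
  ... | x , x∈ , refl = x∈

∣p∪q∣≤∣p∣+∣q∣ : ∀ {n} (p q : Subset n) → ∣ p ∪ q ∣ ≤ ∣ p ∣ + ∣ q ∣
∣p∪q∣≤∣p∣+∣q∣ []          []          = z≤n
∣p∪q∣≤∣p∣+∣q∣ (true ∷ p)  (true ∷ q)  =
  s≤s (≤-trans (∣p∪q∣≤∣p∣+∣q∣ p q) (+-monoʳ-≤ ∣ p ∣ (n≤1+n ∣ q ∣)))
∣p∪q∣≤∣p∣+∣q∣ (true ∷ p)  (false ∷ q) = s≤s (∣p∪q∣≤∣p∣+∣q∣ p q)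
∣p∪q∣≤∣p∣+∣q∣ (false ∷ p) (true ∷ q)  =
  ≤-trans (s≤s (∣p∪q∣≤∣p∣+∣q∣ p q)) (≤-reflexive (sym (+-suc ∣ p ∣ ∣ q ∣)))
∣p∪q∣≤∣p∣+∣q∣ (false ∷ p) (false ∷ q) = ∣p∪q∣≤∣p∣+∣q∣ p q

∣img∣≤ : ∀ {m n} (φ : Fin m → Fin n) s → ∣ img φ s ∣ ≤ ∣ s ∣
∣img∣≤ {n = n} φ [] = ≤-reflexive (∣⊥∣≡0 n)
∣img∣≤ φ (true ∷ s)  = ≤-trans (∣p∪q∣≤∣p∣+∣q∣ ⁅ φ zero ⁆ _)
  (+-mono-≤ (≤-reflexive (∣⁅x⁆∣≡1 (φ zero))) (∣img∣≤ (φ ∘ suc) s))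
∣img∣≤ φ (false ∷ s) = ∣img∣≤ (φ ∘ suc) s

-- If two distinct elements of `s` had the same image, one of them could be removed without changing
-- the image, which would then have fewer than `∣ s ∣` elements.
card-img⇒injective : ∀ {m n} (φ : Fin m → Fin n) {s a b} → ∣ s ∣ ≤ ∣ img φ s ∣ →
  a ∈ s → b ∈ s → φ a ≡ φ b → a ≡ b
card-img⇒injective φ {s} {a} {b} size a∈ b∈ eq with a ≟ᶠ b
... | yes a≡b = a≡b
... | no a≢b = ⊥-elim (<-irrefl refl (<-≤-trans (x∈p⇒∣p-x∣<∣p∣ b∈) (≤-trans size
                  (≤-trans (p⊆q⇒∣p∣≤∣q∣ shrink) (∣img∣≤ φ (s - b))))))
  where
  shrink : img φ s ⊆ img φ (s - b)
  shrink y∈ with ∈-img⁻ φ s y∈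
  ... | x , x∈ , refl with x ≟ᶠ b
  ...   | yes refl = subst (_∈ img φ (s - b)) eq (∈-img⁺ φ (x∈p∧x≢y⇒x∈p-y a∈ a≢b))
  ...   | no x≢b   = ∈-img⁺ φ (x∈p∧x≢y⇒x∈p-y x∈ x≢b)

∣img∣-injective : ∀ {m n} (φ : Fin m → Fin n) → Injective _≡_ _≡_ φ → ∀ s → ∣ img φ s ∣ ≡ ∣ s ∣
∣img∣-injective {n = n} φ inj []          = ∣⊥∣≡0 n
∣img∣-injective φ inj (false ∷ s) = ∣img∣-injective (φ ∘ suc) (sucᶠ-injective ∘ inj) s
∣img∣-injective {n = n} φ inj (true ∷ s)  =
  trans (∣⁅x⁆∪p∣ (φ zero) (img (φ ∘ suc) s) fresh) (cong suc (∣img∣-injective (φ ∘ suc) (sucᶠ-injective ∘ inj) s))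
  where
  fresh : φ zero ∉ img (φ ∘ suc) s
  fresh z∈ with ∈-img⁻ (φ ∘ suc) s z∈
  ... | x , _ , eq with inj eq
  ... | ()
  ∣⁅x⁆∪p∣ : ∀ {n} (x : Fin n) (p : Subset n) → x ∉ p → ∣ ⁅ x ⁆ ∪ p ∣ ≡ suc ∣ p ∣
  ∣⁅x⁆∪p∣ zero    (true ∷ p)  x∉p = ⊥-elim (x∉p here)
  ∣⁅x⁆∪p∣ zero    (false ∷ p) x∉p = cong suc (cong ∣_∣ (∪-identityˡ p))
  ∣⁅x⁆∪p∣ (suc x) (true ∷ p)  x∉p = cong suc (∣⁅x⁆∪p∣ x p (x∉p ∘ there))
  ∣⁅x⁆∪p∣ (suc x) (false ∷ p) x∉p = ∣⁅x⁆∪p∣ x p (x∉p ∘ there)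

img-injective : ∀ {m n} (φ : Fin m → Fin n) → Injective _≡_ _≡_ φ → ∀ {s t} → img φ s ≡ img φ t → s ≡ t
img-injective φ inj {s} {t} eq = ⊆-antisym (half s t eq) (half t s (sym eq))
  where
  half : ∀ s t → img φ s ≡ img φ t → s ⊆ t
  half s t eq x∈ with ∈-img⁻ φ t (subst (φ _ ∈_) eq (∈-img⁺ φ x∈))
  ... | y , y∈ , e with inj e
  ... | refl = y∈

p⊆q∧∣q∣≤∣p∣⇒p≡q : ∀ {n} {p q : Subset n} → p ⊆ q → ∣ q ∣ ≤ ∣ p ∣ → p ≡ q
p⊆q∧∣q∣≤∣p∣⇒p≡q {p = p} {q} p⊆q size = ⊆-antisym p⊆q q⊆p
  where
  q⊆p : q ⊆ p
  q⊆p {x} x∈q with x ∈? p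
  ... | yes x∈p = x∈p
  ... | no x∉p = ⊥-elim (<-irrefl refl (<-≤-trans (p⊂q⇒∣p∣<∣q∣ (p⊆q , x , x∈q , x∉p)) size))

-- Edges are also handled as `k`-tuples, which can be sampled one coordinate at a time. A tuple with
-- a repeated entry has a set with fewer than `k` elements.
vset : ∀ {n k} → Vec (Fin n) k → Subset n
vset v = img (lookup v) ⊤

vset-map : ∀ {m n k} (h : Fin m → Fin n) (v : Vec (Fin m) k) → vset (Vec.map h v) ≡ img h (vset v)
vset-map h v = trans (img-cong ⊤ (λ {x} _ → lookup-map x h v)) (sym (img-∘ h (lookup v) ⊤))

vset⇒injective : ∀ {n k} (v : Vec (Fin n) k) → k ≤ ∣ vset v ∣ → Injective _≡_ _≡_ (lookup v)
vset⇒injective {k = k} v size eq =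
  card-img⇒injective (lookup v) (≤-trans (≤-reflexive (∣⊤∣≡n k)) size) ∈⊤ ∈⊤ eq

vec-ext : ∀ {A : Set} {k} {u v : Vec A k} → (∀ i → lookup u i ≡ lookup v i) → u ≡ v
vec-ext {u = u} {v} eq = trans (sym (tabulate∘lookup u)) (trans (tabulate-cong eq) (tabulate∘lookup v))

img-suc : ∀ {n} (s : Subset n) → img suc s ≡ false ∷ s
img-suc s = ⊆-antisym to from
  where
  to : img suc s ⊆ false ∷ s
  to y∈ with ∈-img⁻ suc s y∈
  ... | x , x∈ , refl = there x∈
  from : false ∷ s ⊆ img suc s
  from (there x∈) = ∈-img⁺ suc x∈

enumerate : ∀ {n} (s : Subset n) → ∃[ v ] vset {n} {∣ s ∣} v ≡ s
enumerate []          = [] , refl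
enumerate (false ∷ s) with enumerate s
... | v , eq = Vec.map suc v , trans (vset-map suc v) (trans (cong (img suc) eq) (img-suc s))
enumerate (true ∷ s)  with enumerate s
... | v , eq = zero ∷ Vec.map suc v , trans
  (cong (⁅ zero ⁆ ∪_) (trans (vset-map suc v) (trans (cong (img suc) eq) (img-suc s))))
  (cong (true ∷_) (∪-identityˡ s))

-- One order is fixed for each edge, so there are as many tuples as edges, without a factor `k!`.
ordered-edges : ∀ {k n} (H : Hypergraph k n) → ∃[ O ] map (vset {n} {k}) O ≡ edges H
ordered-edges H = go (edges H) (uniform H)
  where
  go : ∀ {k n} (es : List (Subset n)) → All (λ s → ∣ s ∣ ≡ k) es → ∃[ O ] map (vset {n} {k}) O ≡ es
  go []       []         = [] , refl
  go (s ∷ es) (refl ∷ u) with enumerate s | go es u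
  ... | v , eq | O , eqs = v ∷ O , cong₂ _∷_ eq eqs

-- Homomorphisms and Cauchy–Schwarz

square-cancel-≤ : ∀ a b → a * a ≤ b * b → a ≤ b
square-cancel-≤ a b a²≤b² with a ≤? b
... | yes a≤b = a≤b
... | no a≰b = ⊥-elim (<⇒≱ (*-mono-< (≰⇒> a≰b) (≰⇒> a≰b)) a²≤b²)

*-cancelˡ-≤-pos : ∀ {n a b} → 1 ≤ n → n * a ≤ n * b → a ≤ b
*-cancelˡ-≤-pos {suc n} (s≤s _) = *-cancelˡ-≤ (suc n)

-- The map `α` tells which coordinate of `z` gives the image of a vertex, so vertices with a common
-- coordinate are identified. Coordinates outside the range of `α` stay free; all counts thus refer
-- to the same total `n ^ D`, while `α` changes.
IsHom : ∀ {k vG n D} → Hypergraph k vG → Hypergraph k n → (Fin vG → Fin D) → Vec (Fin n) D → Set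
IsHom G H α z = All (λ s → img (lookup z ∘ α) s LM.∈ edges H) (edges G)

isHom? : ∀ {k vG n D} (G : Hypergraph k vG) (H : Hypergraph k n) (α : Fin vG → Fin D) → Decidable (IsHom G H α)
isHom? G H α z = All.all? (λ s → img (lookup z ∘ α) s ∈ˢ? edges H) (edges G)

#hom : ∀ {k vG n D} → Hypergraph k vG → Hypergraph k n → (Fin vG → Fin D) → ℕ
#hom {n = n} {D} G H α = ∑ (vecs n D) (λ z → 𝟙 (isHom? G H α z))

choose : ∀ {P A : Set} → Dec P → A → A → A
choose (yes _) a b = a
choose (no _)  a b = b

reassign : ∀ {m D} → (Fin m → Fin D) → Fin m → Fin D → (Fin m → Fin D)
reassign α v d u = choose (u ≟ᶠ v) d (α u)

module _ {k vG n D : ℕ} (G : Hypergraph k vG) (H : Hypergraph k n) where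

  -- Edges on both sides have `k` elements, so a homomorphism cannot collapse an edge.
  hom-injective-on-edges : ∀ {φ : Fin vG → Fin n} {s a b} → s LM.∈ edges G → img φ s LM.∈ edges H →
    a ∈ s → b ∈ s → φ a ≡ φ b → a ≡ b
  hom-injective-on-edges {φ} s∈ img∈ = card-img⇒injective φ
    (≤-reflexive (trans (All.lookup (uniform G) s∈) (sym (All.lookup (uniform H) img∈))))

  -- The vertex `v` moves to the fresh coordinate `d` with value `y`, and the others keep `x` at the
  -- old coordinate. On an edge through `v` no other vertex shares its coordinate, as homomorphisms
  -- are injective on edges, so only `y` is seen; an edge avoiding `v` is mapped as by the
  -- homomorphism with `x`.
  split-vertex : ∀ (α : Fin vG → Fin D) v d → (∀ u → α u ≢ d) → ∀ z x y →
    IsHom G H α (z [ α v ]≔ x) → IsHom G H α (z [ α v ]≔ y) →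
    IsHom G H (reassign α v d) ((z [ α v ]≔ x) [ d ]≔ y)
  split-vertex α v d fresh z x y homx homy = All.tabulate edge
    where
    αᵥ = α v
    new = (z [ αᵥ ]≔ x) [ d ]≔ y
    edge : ∀ {s} → s LM.∈ edges G → img (lookup new ∘ reassign α v d) s LM.∈ edges H
    edge {s} s∈ with v ∈? s
    ... | yes v∈ = subst (LM._∈ edges H) (img-cong s same) (All.lookup homy s∈)
      where
      same : ∀ {u} → u ∈ s → lookup (z [ αᵥ ]≔ y) (α u) ≡ lookup new (reassign α v d u)
      same {u} u∈ with u ≟ᶠ v
      ... | yes refl = trans (lookup∘update αᵥ z y) (sym (lookup∘update d (z [ αᵥ ]≔ x) y))
      ... | no u≢v   = begin
        lookup (z [ αᵥ ]≔ y) (α u)  ≡⟨ lookup∘update′ off z y ⟩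
        lookup z (α u)              ≡⟨ sym (lookup∘update′ off z x) ⟩
        lookup (z [ αᵥ ]≔ x) (α u)  ≡⟨ sym (lookup∘update′ (fresh u) (z [ αᵥ ]≔ x) y) ⟩
        lookup new (α u)            ∎
        where
        open ≡-Reasoning
        off : α u ≢ αᵥ
        off eq = u≢v (hom-injective-on-edges s∈ (All.lookup homy s∈) u∈ v∈ (cong (lookup (z [ αᵥ ]≔ y)) eq))
    ... | no v∉ = subst (LM._∈ edges H) (img-cong s same) (All.lookup homx s∈)
      where
      same : ∀ {u} → u ∈ s → lookup (z [ αᵥ ]≔ x) (α u) ≡ lookup new (reassign α v d u)
      same {u} u∈ with u ≟ᶠ v
      ... | yes refl = ⊥-elim (v∉ u∈)
      ... | no u≢v   = sym (lookup∘update′ (fresh u) (z [ αᵥ ]≔ x) y)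

  -- Cauchy–Schwarz over the choice of the coordinates other than α v.
  #hom-split : ∀ (α : Fin vG → Fin D) v d → (∀ u → α u ≢ d) → 1 ≤ n →
    #hom G H α * #hom G H α ≤ n ^ D * #hom G H (reassign α v d)
  #hom-split α v d fresh 1≤n = *-cancelˡ-≤-pos (*-mono-≤ 1≤n 1≤n) (begin
    (n * n) * (N * N)                                       ≡⟨ regroup n N ⟩
    (n * N) * (n * N)                                       ≡⟨ cong₂ _*_ (sym resampled) (sym resampled) ⟩
    ∑ Ω a * ∑ Ω a                                           ≤⟨ cauchy-schwarz Ω a ⟩
    length Ω * ∑ Ω (λ z → a z * a z)                               ≤⟨ *-mono-≤ (≤-reflexive (length-vecs D)) (∑-mono Ω pairs) ⟩
    n ^ D * ∑ Ω (λ z → ∑ V (λ x → g (z [ α v ]≔ x)))        ≡⟨ cong (n ^ D *_) (trans (resample (α v) g) (cong (n *_) (resample d _))) ⟩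
    n ^ D * (n * (n * N′))                                  ≡⟨ regroup′ (n ^ D) n N′ ⟩
    (n * n) * (n ^ D * N′)                                  ∎)
    where
    open ≤-Reasoning
    Ω = vecs n D
    V = allFin n
    α′ = reassign α v d
    N = #hom G H α
    N′ = #hom G H α′
    q : Vec (Fin n) D → ℕ
    q z = 𝟙 (isHom? G H α z)
    a : Vec (Fin n) D → ℕ
    a z = ∑ V (λ x → q (z [ α v ]≔ x))
    g : Vec (Fin n) D → ℕ
    g z = ∑ V (λ y → 𝟙 (isHom? G H α′ (z [ d ]≔ y)))
    resampled : ∑ Ω a ≡ n * N
    resampled = resample (α v) q
    regroup : ∀ a b → (a * a) * (b * b) ≡ (a * b) * (a * b)
    regroup = solve-∀
    regroup′ : ∀ a b c → a * (b * (b * c)) ≡ (b * b) * (a * c)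
    regroup′ = solve-∀
    -- The square of `a z` counts pairs of admissible values for the coordinate `α v`; each pair
    -- gives one homomorphism for `α′`, with the second value stored at `d`.
    pairs : ∀ z → a z * a z ≤ ∑ V (λ x → g (z [ α v ]≔ x))
    pairs z = begin
      a z * a z                                                             ≡⟨ sym (∑-*ʳ V (a z) _) ⟩
      ∑ V (λ x → q (z [ α v ]≔ x) * a z)                                    ≡⟨ ∑-cong V (λ x → sym (∑-*ˡ V (q (z [ α v ]≔ x)) _)) ⟩
      ∑ V (λ x → ∑ V (λ y → q (z [ α v ]≔ x) * q (z [ α v ]≔ y)))           ≤⟨ ∑-mono V (λ x → ∑-mono V (λ y →
                                                                                 𝟙-pairwise (isHom? G H α (z [ α v ]≔ x)) (isHom? G H α (z [ α v ]≔ y)) (isHom? G H α′ ((z [ α v ]≔ x) [ d ]≔ y))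
                                                                                   (split-vertex α v d fresh z x y))) ⟩
      ∑ V (λ x → g (z [ α v ]≔ x))                                          ∎

module _ {k vG n M : ℕ} (G : Hypergraph k vG) (H : Hypergraph k n) (1≤n : 1 ≤ n) (φ : Fin vG → Fin M) where

  -- The vertices below j have received private coordinates, the others still share those of φ.
  stage : ℕ → Fin vG → Fin (vG + M)
  stage j u = choose (toℕ u <? j) (u ↑ˡ M) (vG ↑ʳ φ u)

  stage-new : ∀ {j} u → toℕ u < j → stage j u ≡ u ↑ˡ M
  stage-new {j} u u<j with toℕ u <? j
  ... | yes _ = refl
  ... | no u≮j = ⊥-elim (u≮j u<j)

  stage-old : ∀ {j} u → ¬ toℕ u < j → stage j u ≡ vG ↑ʳ φ u
  stage-old {j} u u≮j with toℕ u <? j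
  ... | yes u<j = ⊥-elim (u≮j u<j)
  ... | no _ = refl

  ↑ˡ≢↑ʳ : ∀ (u : Fin vG) (w : Fin M) → u ↑ˡ M ≢ vG ↑ʳ w
  ↑ˡ≢↑ʳ u w eq = <⇒≱ (toℕ<n u) (subst (vG ≤_)
    (trans (sym (toℕ-↑ʳ vG w)) (trans (cong toℕ (sym eq)) (toℕ-↑ˡ u M))) (m≤m+n vG (toℕ w)))

  isHom-cong : ∀ {D} {α β : Fin vG → Fin D} → (∀ u → α u ≡ β u) → ∀ z → IsHom G H α z → IsHom G H β z
  isHom-cong eq z = All.map (λ {s} → subst (LM._∈ edges H) (img-cong s (λ {u} _ → cong (lookup z) (eq u))))

  #hom-cong : ∀ {D} {α β : Fin vG → Fin D} → (∀ u → α u ≡ β u) → #hom G H α ≡ #hom G H β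
  #hom-cong {D} {α} {β} eq = ∑-cong (vecs n D) (λ z →
    𝟙-cong (isHom? G H α z) (isHom? G H β z) (isHom-cong eq z) (isHom-cong (sym ∘ eq) z))

  stage-step : ∀ j → j < vG → #hom G H (stage j) * #hom G H (stage j) ≤ n ^ (vG + M) * #hom G H (stage (suc j))
  stage-step j j<vG = ≤-trans (#hom-split G H (stage j) v (v ↑ˡ M) fresh 1≤n)
    (≤-reflexive (cong (n ^ (vG + M) *_) (#hom-cong next)))
    where
    v = fromℕ< j<vG
    v≡j : toℕ v ≡ j
    v≡j = toℕ-fromℕ< j<vG
    fresh : ∀ u → stage j u ≢ v ↑ˡ M
    fresh u eq with toℕ u <? j
    ... | yes u<j = <-irrefl (trans (cong toℕ (↑ˡ-injective M u v eq)) v≡j) u<j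
    ... | no _    = ↑ˡ≢↑ʳ v (φ u) (sym eq)
    next : ∀ u → reassign (stage j) v (v ↑ˡ M) u ≡ stage (suc j) u
    next u with u ≟ᶠ v
    ... | yes refl = sym (stage-new u (s≤s (≤-reflexive v≡j)))
    ... | no u≢v with toℕ u <? j
    ...   | yes u<j = sym (stage-new u (m≤n⇒m≤1+n u<j))
    ...   | no u≮j  = sym (stage-old u λ { (s≤s u≤j) → u≢v (toℕ-injective (trans (≤-antisym u≤j (≮⇒≥ u≮j)) (sym v≡j))) })

  -- Densities are squared at each of the vG stages.
  stage-small : ∀ j → j ≤ vG → ∀ p → p ^ (2 ^ j) * #hom G H (stage j) ≤ n ^ (vG + M) →
                p * #hom G H (stage 0) ≤ n ^ (vG + M)
  stage-small zero    _    p small = ≤-trans (≤-reflexive (cong (_* #hom G H (stage 0)) (sym (*-identityʳ p)))) small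
  stage-small (suc j) j<vG p small = stage-small j (<⇒≤ j<vG) p (square-cancel-≤ _ _ (begin
    (P * N) * (P * N)        ≡⟨ regroup P N ⟩
    (P * P) * (N * N)        ≤⟨ *-monoʳ-≤ (P * P) (stage-step j j<vG) ⟩
    (P * P) * (W * N′)       ≡⟨ regroup′ P W N′ ⟩
    W * ((P * P) * N′)       ≡⟨ cong (λ t → W * (t * N′)) (sym (trans (cong (p ^_) (cong (2 ^ j +_) (+-identityʳ (2 ^ j)))) (^-distribˡ-+-* p (2 ^ j) (2 ^ j)))) ⟩
    W * (p ^ (2 ^ suc j) * N′) ≤⟨ *-monoʳ-≤ W small ⟩
    W * W                    ∎))
    where
    open ≤-Reasoning
    P = p ^ (2 ^ j)
    W = n ^ (vG + M)
    N = #hom G H (stage j)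
    N′ = #hom G H (stage (suc j))
    regroup : ∀ a b → (a * b) * (a * b) ≡ (a * a) * (b * b)
    regroup = solve-∀
    regroup′ : ∀ a b c → (a * a) * (b * c) ≡ b * ((a * a) * c)
    regroup′ = solve-∀

  -- With private coordinates for all vertices the density of homomorphisms is at most `C / n`. Each
  -- of the `vG` stages back to `φ` costs a square root, so the final density is at most the
  -- `2 ^ vG`-th root of `C / n`, hence at most `1 / p`.
  few-injective⇒few : ∀ p C → n * #hom G H (λ u → u ↑ˡ M) ≤ C * n ^ (vG + M) → C * p ^ (2 ^ vG) ≤ n →
    p * #hom G H (λ u → vG ↑ʳ φ u) ≤ n ^ (vG + M)
  few-injective⇒few p C few large = subst (λ t → p * t ≤ W) (#hom-cong {α = stage 0} (λ u → stage-old {0} u λ ()))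
    (stage-small vG ≤-refl p (subst (λ t → P * t ≤ W) (sym (#hom-cong {α = stage vG} (λ u → stage-new u (toℕ<n u))))
      (*-cancelˡ-≤-pos 1≤n (begin
        n * (P * N)     ≡⟨ regroup n P N ⟩
        P * (n * N)     ≤⟨ *-monoʳ-≤ P few ⟩
        P * (C * W)     ≡⟨ regroup′ P C W ⟩
        C * P * W       ≤⟨ *-monoˡ-≤ W large ⟩
        n * W           ∎))))
    where
    open ≤-Reasoning
    P = p ^ (2 ^ vG)
    W = n ^ (vG + M)
    N = #hom G H (λ u → u ↑ˡ M)
    regroup : ∀ a b c → a * (b * c) ≡ b * (a * c)
    regroup = solve-∀
    regroup′ : ∀ a b c → a * (b * c) ≡ b * a * c
    regroup′ = solve-∀

-- Ordered edges

length-cartesianProduct : ∀ (xs : List A) (ys : List B) → length (cartesianProduct xs ys) ≡ length xs * length ys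
length-cartesianProduct []       ys = refl
length-cartesianProduct (x ∷ xs) ys = trans (LP.length-++ (map (x ,_) ys))
  (cong₂ _+_ (LP.length-map (x ,_) ys) (length-cartesianProduct xs ys))

length-pairs : ∀ m n → length (cartesianProduct (allFin m) (allFin n)) ≡ m * n
length-pairs m n = trans (length-cartesianProduct (allFin m) (allFin n)) (cong₂ _*_ (length-allFin {m}) (length-allFin {n}))

unique-map-injective : ∀ (f : A → B) {xs x y} → Unique (map f xs) → x LM.∈ xs → y LM.∈ xs → f x ≡ f y → x ≡ y
unique-map-injective f (x∉ ∷ u) (here refl) (here refl) eq = refl
unique-map-injective f (x∉ ∷ u) (here refl) (there y∈)  eq = ⊥-elim (All.lookup x∉ (∈-map⁺ f y∈) eq)
unique-map-injective f (x∉ ∷ u) (there x∈)  (here refl) eq = ⊥-elim (All.lookup x∉ (∈-map⁺ f x∈) (sym eq))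
unique-map-injective f (x∉ ∷ u) (there x∈)  (there y∈)  eq = unique-map-injective f u x∈ y∈ eq

injective-on⇒unique-map : ∀ (f : A → B) {xs} → Unique xs →
  (∀ {x y} → x LM.∈ xs → y LM.∈ xs → f x ≡ f y → x ≡ y) → Unique (map f xs)
injective-on⇒unique-map f []       inj = []
injective-on⇒unique-map f (x∉ ∷ u) inj =
  Allₚ.map⁺ (All.tabulate (λ y∈ eq → All.lookup x∉ y∈ (inj (here refl) (there y∈) eq)))
  ∷ injective-on⇒unique-map f u (λ x∈ y∈ → inj (there x∈) (there y∈))

unique-lookup-injective : ∀ {xs : List A} → Unique xs → ∀ i j → List.lookup xs i ≡ List.lookup xs j → i ≡ j
unique-lookup-injective (x∉ ∷ u) zero    zero    eq = refl
unique-lookup-injective (x∉ ∷ u) zero    (suc j) eq = ⊥-elim (All.lookup x∉ (∈-lookup j) eq)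
unique-lookup-injective (x∉ ∷ u) (suc i) zero    eq = ⊥-elim (All.lookup x∉ (∈-lookup i) (sym eq))
unique-lookup-injective (x∉ ∷ u) (suc i) (suc j) eq = cong suc (unique-lookup-injective u i j eq)

collision-or-injective : ∀ {m n} (f : Fin m → Fin n) → (∃[ i ] ∃[ j ] (i ≢ j × f i ≡ f j)) ⊎ Injective _≡_ _≡_ f
collision-or-injective f with any? (λ i → any? (λ j → ¬? (i ≟ᶠ j) ×-dec f i ≟ᶠ f j))
... | yes collision = inj₁ collision
... | no none = inj₂ inj
  where
  inj : Injective _≡_ _≡_ f
  inj {i} {j} eq with i ≟ᶠ j
  ... | yes i≡j = i≡j
  ... | no i≢j  = ⊥-elim (none (i , j , i≢j , eq))

∑-𝟙-confined : DecidableEquality A → {xs : List A} → Unique xs → {P : A → Set} (P? : Decidable P) (ys : List A) →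
  (∀ {x} → P x → x LM.∈ ys) → ∑ xs (λ x → 𝟙 (P? x)) ≤ length ys
∑-𝟙-confined _≟_ {xs} u P? ys P⊆ys = begin
  ∑ xs (λ x → 𝟙 (P? x))                   ≤⟨ ∑-mono xs (λ x → 𝟙-elim (P? x) (hit x)) ⟩
  ∑ xs (λ x → ∑ ys (λ y → 𝟙 (x ≟ y)))     ≡⟨ ∑-swap xs ys _ ⟩
  ∑ ys (λ y → ∑ xs (λ x → 𝟙 (x ≟ y)))     ≤⟨ ∑-bound ys (λ y → ∑-disjoint≤1 (_≟ y) u (λ p q → trans p (sym q))) ⟩
  length ys * 1                           ≡⟨ *-identityʳ (length ys) ⟩
  length ys                               ∎
  where
  open ≤-Reasoning
  hit : ∀ x → _ → 1 ≤ ∑ ys (λ y → 𝟙 (x ≟ y))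
  hit x p = ≤-trans (≤-reflexive (sym (𝟙-yes (x ≟ x) refl))) (∑-member (λ y → 𝟙 (x ≟ y)) (P⊆ys p))

∑-allFin-𝟙-confined : ∀ {n} {P : Fin n → Set} (P? : Decidable P) (ys : List (Fin n)) →
  (∀ {x} → P x → x LM.∈ ys) → ∑ (allFin n) (λ x → 𝟙 (P? x)) ≤ length ys
∑-allFin-𝟙-confined {n} P? ys P⊆ys = ∑-𝟙-confined _≟ᶠ_ (Uniqueₚ.allFin⁺ n) P? ys P⊆ys

map-lookup-update : ∀ {n D k} (z : Vec (Fin n) D) {b} x (β : Vec (Fin D) k) → (∀ i → lookup β i ≢ b) →
  Vec.map (lookup (z [ b ]≔ x)) β ≡ Vec.map (lookup z) β
map-lookup-update z x []      off = refl
map-lookup-update z x (c ∷ β) off = cong₂ _∷_ (lookup∘update′ (off zero) z x) (map-lookup-update z x β (off ∘ suc))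

-- A uniform vector takes prescribed values at `k` distinct coordinates with probability at least
-- `n ^ k` inverted. In the induction, resampling the coordinate `b` hits `x` for one of `n` values
-- and does not disturb the other coordinates, which differ from `b`.
prescribed-coordinates : ∀ {n D k} (β : Vec (Fin D) k) → Injective _≡_ _≡_ (lookup β) → (t : Vec (Fin n) k) →
  n ^ D ≤ n ^ k * ∑ (vecs n D) (λ z → 𝟙 (Vec.map (lookup z) β ≟ᵛ t))
prescribed-coordinates {n} {D} [] inj [] = ≤-reflexive (begin-equality
  n ^ D                                ≡⟨ sym (*-identityʳ (n ^ D)) ⟩
  n ^ D * 1                            ≡⟨ sym (∑-vecs-const D 1) ⟩
  ∑ (vecs n D) (λ _ → 1)               ≡⟨ sym (*-identityˡ _) ⟩
  1 * ∑ (vecs n D) (λ _ → 1)           ∎)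
  where open ≤-Reasoning
prescribed-coordinates {n} {D} {suc k} (b ∷ β) inj (x ∷ t) = begin
  n ^ D                                     ≤⟨ prescribed-coordinates β (λ eq → tail-injective (inj eq)) t ⟩
  n ^ k * ∑ (vecs n D) tailMatch            ≤⟨ *-monoʳ-≤ (n ^ k) (∑-mono (vecs n D) extend) ⟩
  n ^ k * ∑ (vecs n D) (λ z → ∑ (allFin n) (λ y → match (z [ b ]≔ y)))
                                            ≡⟨ cong (n ^ k *_) (resample b match) ⟩
  n ^ k * (n * ∑ (vecs n D) match)          ≡⟨ regroup (n ^ k) n _ ⟩
  n * n ^ k * ∑ (vecs n D) match            ∎
  where
  open ≤-Reasoning
  regroup : ∀ a b c → a * (b * c) ≡ b * a * c
  regroup = solve-∀
  tail-injective : ∀ {m} {i j : Fin m} → Fin.suc i ≡ suc j → i ≡ j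
  tail-injective refl = refl
  tailMatch match : Vec (Fin n) D → ℕ
  tailMatch z = 𝟙 (Vec.map (lookup z) β ≟ᵛ t)
  match z = 𝟙 (Vec.map (lookup z) (b ∷ β) ≟ᵛ (x ∷ t))
  off : ∀ i → lookup β i ≢ b
  off i eq with inj {suc i} {zero} eq
  ... | ()
  extend : ∀ z → tailMatch z ≤ ∑ (allFin n) (λ y → match (z [ b ]≔ y))
  extend z = ≤-trans
    (𝟙-mono (Vec.map (lookup z) β ≟ᵛ t) (Vec.map (lookup (z [ b ]≔ x)) (b ∷ β) ≟ᵛ (x ∷ t))
      (λ eq → cong₂ _∷_ (lookup∘update b z x) (trans (map-lookup-update z x β off) eq)))
    (∑-member (λ y → match (z [ b ]≔ y)) (∈-allFin x))

∑-𝟙≟≤𝟙∈ : ∀ {n k} {O : List (Vec (Fin n) k)} → Unique O → ∀ v → ∑ O (λ t → 𝟙 (v ≟ᵛ t)) ≤ 𝟙 (v ∈ᵛ? O)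
∑-𝟙≟≤𝟙∈ {O = O} u v with v ∈ᵛ? O
... | yes _ = ∑-disjoint≤1 (v ≟ᵛ_) u (λ p q → trans (sym p) q)
... | no v∉ = ≤-reflexive (vanish O v∉)
  where
  vanish : ∀ O → ¬ v LM.∈ O → ∑ O (λ t → 𝟙 (v ≟ᵛ t)) ≡ 0
  vanish []      v∉ = refl
  vanish (t ∷ O) v∉ = cong₂ _+_ (𝟙-no (v ≟ᵛ t) (v∉ ∘ here)) (vanish O (v∉ ∘ there))

-- The events that the sampled tuple equals the various members of `O` are disjoint, so their
-- probabilities add up.
prescribed-members : ∀ {n D k} (β : Vec (Fin D) k) → Injective _≡_ _≡_ (lookup β) → {O : List (Vec (Fin n) k)} → Unique O →
  length O * n ^ D ≤ n ^ k * ∑ (vecs n D) (λ z → 𝟙 (Vec.map (lookup z) β ∈ᵛ? O))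
prescribed-members {n} {D} {k} β inj {O} u = begin
  length O * n ^ D                      ≡⟨ sym (∑-const O (n ^ D)) ⟩
  ∑ O (λ _ → n ^ D)                     ≤⟨ ∑-mono O (prescribed-coordinates β inj) ⟩
  ∑ O (λ t → n ^ k * ∑ Ω (λ z → 𝟙 (at z ≟ᵛ t)))  ≡⟨ trans (∑-*ˡ O (n ^ k) _) (cong (n ^ k *_) (∑-swap O Ω _)) ⟩
  n ^ k * ∑ Ω (λ z → ∑ O (λ t → 𝟙 (at z ≟ᵛ t)))  ≤⟨ *-monoʳ-≤ (n ^ k) (∑-mono Ω (λ z → ∑-𝟙≟≤𝟙∈ u (at z))) ⟩
  n ^ k * ∑ Ω (λ z → 𝟙 (at z ∈ᵛ? O))    ∎
  where
  open ≤-Reasoning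
  Ω = vecs n D
  at : Vec (Fin n) D → Vec (Fin n) k
  at z = Vec.map (lookup z) β

-- Sampling exactly the `k` coordinates turns the density of `O` into a lower bound for a
-- probability, which is at most 1.
members≤n^k : ∀ {n k} → 1 ≤ n → {O : List (Vec (Fin n) k)} → Unique O → length O ≤ n ^ k
members≤n^k {n} {k} 1≤n {O} u = *-cancelˡ-≤-pos (1≤n^ k) (begin
  n ^ k * length O    ≡⟨ *-comm (n ^ k) (length O) ⟩
  length O * n ^ k    ≤⟨ prescribed-members (Vec.allFin k) allFin-injective u ⟩
  n ^ k * ∑ Ω (λ z → 𝟙 (Vec.map (lookup z) (Vec.allFin k) ∈ᵛ? O))
                      ≤⟨ *-monoʳ-≤ (n ^ k) (∑-mono Ω (λ z → 𝟙≤1 (Vec.map (lookup z) (Vec.allFin k) ∈ᵛ? O))) ⟩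
  n ^ k * ∑ Ω (λ _ → 1)  ≡⟨ cong (n ^ k *_) (trans (∑-vecs-const k 1) (*-identityʳ _)) ⟩
  n ^ k * n ^ k       ∎)
  where
  open ≤-Reasoning
  Ω = vecs n k
  1≤n^ : ∀ k → 1 ≤ n ^ k
  1≤n^ k = m^n>0 n {{>-nonZero 1≤n}} k
  allFin-injective : Injective _≡_ _≡_ (lookup (Vec.allFin k))
  allFin-injective {i} {j} eq = trans (sym (lookup∘tabulate id i)) (trans eq (lookup∘tabulate id j))

module OrderedEdges {k n : ℕ} (H : Hypergraph k n) where
  O : List (Vec (Fin n) k)
  O = proj₁ (ordered-edges H)

  vset-O : map vset O ≡ edges H
  vset-O = proj₂ (ordered-edges H)

  length-O : length O ≡ e H
  length-O = trans (sym (LP.length-map vset O)) (cong length vset-O)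

  unique-vset-O : Unique (map vset O)
  unique-vset-O = subst Unique (sym vset-O) (distinct H)

  unique-O : Unique O
  unique-O = Uniqueₚ.map⁻ unique-vset-O

  vset∈ : ∀ {v} → v LM.∈ O → vset v LM.∈ edges H
  vset∈ v∈ = subst (_ LM.∈_) vset-O (∈-map⁺ vset v∈)

  O-injective : ∀ {v} → v LM.∈ O → Injective _≡_ _≡_ (lookup v)
  O-injective {v} v∈ = vset⇒injective v (≤-reflexive (sym (All.lookup (uniform H) (vset∈ v∈))))

-- Sparsity of hypergraphs free of a k-partite F

module _ {k n vF : ℕ} (F : Hypergraph k vF) (H : Hypergraph k n) (c : Fin vF → Fin k)
  (partite : All (λ s → ∀ (j : Fin k) →
      (∃[ x ] (x ∈ s × c x ≡ j)) ×
      (∀ x y → x ∈ s → y ∈ s → c x ≡ j → c y ≡ j → x ≡ y)) (edges F)) where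
  open OrderedEdges H

  private
    D = vF + k
    β = Vec.tabulate {n = k} (vF ↑ʳ_)

  -- A `k`-partite `F` maps to a single edge: each edge of `F` meets all `k` colours, so its image
  -- is the whole edge whose vertices are placed at the colour coordinates.
  ordered-edge⇒hom : ∀ (z : Vec (Fin n) D) → Vec.map (lookup z) β LM.∈ O → IsHom F H (λ u → vF ↑ʳ c u) z
  ordered-edge⇒hom z t∈ = All.tabulate λ s∈ → subst (LM._∈ edges H) (onto s∈) (vset∈ t∈)
    where
    at : ∀ j → lookup (Vec.map (lookup z) β) j ≡ lookup z (vF ↑ʳ j)
    at j = trans (lookup-map j (lookup z) β) (cong (lookup z) (lookup∘tabulate (vF ↑ʳ_) j))
    c-onto : ∀ {s} → s LM.∈ edges F → ⊤ ≡ img c s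
    c-onto {s} s∈ = ⊆-antisym (λ {j} _ → hits j) (λ _ → ∈⊤)
      where
      hits : ∀ j → j ∈ img c s
      hits j with proj₁ (All.lookup partite s∈ j)
      ... | x , x∈ , refl = ∈-img⁺ c x∈
    onto : ∀ {s} → s LM.∈ edges F → vset (Vec.map (lookup z) β) ≡ img (λ u → lookup z (vF ↑ʳ c u)) s
    onto {s} s∈ = trans (img-cong ⊤ (λ {j} _ → at j))
      (trans (cong (img (λ j → lookup z (vF ↑ʳ j))) (c-onto s∈)) (img-∘ _ c s))

  -- In an `F`-free hypergraph all homomorphisms from `F` are non-injective, so some vertex is
  -- determined by another and their density is at most `vF * vF / n`. This makes the homomorphisms
  -- through `c` sparse too, and their density is at least that of the ordered edges.
  partite-density : ∀ p → ¬ Copy F H → 1 ≤ n → vF * vF * p ^ (2 ^ vF) ≤ n → p * e H ≤ n ^ k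
  partite-density p free 1≤n large = *-cancelˡ-≤-pos (m^n>0 n {{>-nonZero 1≤n}} D) (begin
    W * (p * e H)           ≡⟨ regroup W p (e H) ⟩
    p * (e H * W)           ≤⟨ *-monoʳ-≤ p (subst (λ t → t * W ≤ n ^ k * ∑ Ω (λ z → 𝟙 (at z ∈ᵛ? O))) length-O (prescribed-members β β-injective unique-O)) ⟩
    p * (n ^ k * ∑ Ω (λ z → 𝟙 (at z ∈ᵛ? O)))
                            ≤⟨ *-monoʳ-≤ p (*-monoʳ-≤ (n ^ k) (∑-mono Ω (λ z → 𝟙-mono (at z ∈ᵛ? O) (isHom? F H _ z) (ordered-edge⇒hom z)))) ⟩
    p * (n ^ k * N)         ≡⟨ regroup′ p (n ^ k) N ⟩
    n ^ k * (p * N)         ≤⟨ *-monoʳ-≤ (n ^ k) (few-injective⇒few F H 1≤n c p (vF * vF) few large) ⟩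
    n ^ k * W               ≡⟨ *-comm (n ^ k) W ⟩
    W * n ^ k               ∎)
    where
    open ≤-Reasoning
    W = n ^ D
    Ω = vecs n D
    N = #hom F H (λ u → vF ↑ʳ c u)
    at : Vec (Fin n) D → Vec (Fin n) k
    at z = Vec.map (lookup z) β
    regroup : ∀ a b c → a * (b * c) ≡ b * (c * a)
    regroup = solve-∀
    regroup′ : ∀ a b c → a * (b * c) ≡ b * (a * c)
    regroup′ = solve-∀
    β-injective : Injective _≡_ _≡_ (lookup β)
    β-injective {i} {j} eq = ↑ʳ-injective vF i j
      (trans (sym (lookup∘tabulate (vF ↑ʳ_) i)) (trans eq (lookup∘tabulate (vF ↑ʳ_) j)))
    labels = cartesianProduct (allFin vF) (allFin vF)
    Collide : Fin vF × Fin vF → Vec (Fin n) D → Set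
    Collide (u , v) z = u ≢ v × lookup z (u ↑ˡ k) ≡ lookup z (v ↑ˡ k)
    collide? : ∀ l → Decidable (Collide l)
    collide? (u , v) z = ¬? (u ≟ᶠ v) ×-dec lookup z (u ↑ˡ k) ≟ᶠ lookup z (v ↑ˡ k)
    cover : ∀ z → IsHom F H (λ u → u ↑ˡ k) z → ∃[ l ] (l LM.∈ labels × Collide l z)
    cover z hom with collision-or-injective (λ u → lookup z (u ↑ˡ k))
    ... | inj₁ (u , v , u≢v , eq) = (u , v) , ∈-cartesianProduct⁺ (∈-allFin u) (∈-allFin v) , u≢v , eq
    ... | inj₂ inj = ⊥-elim (free (_ , inj , hom))
    one : ∀ l z → ∑ (allFin n) (λ x → 𝟙 (collide? l (z [ proj₁ l ↑ˡ k ]≔ x))) ≤ 1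
    one (u , v) z = ∑-allFin-𝟙-confined (λ x → collide? (u , v) (z [ u ↑ˡ k ]≔ x)) (lookup z (v ↑ˡ k) ∷ [])
      λ {x} (u≢v , eq) → here (trans (sym (lookup∘update (u ↑ˡ k) z x))
        (trans eq (lookup∘update′ (λ q → u≢v (sym (↑ˡ-injective k v u q))) z x)))
    few : n * #hom F H (λ u → u ↑ˡ k) ≤ vF * vF * W
    few = subst (λ t → n * #hom F H (λ u → u ↑ˡ k) ≤ t * W)
      (trans (*-identityʳ _) (length-pairs vF vF))
      (count-covered labels 1 (λ l → proj₁ l ↑ˡ k) (isHom? F H (λ u → u ↑ˡ k)) collide? cover one)

-- Homomorphisms into a packing without rainbow copies

-- Distinct edges of the same size are not contained in each other.
lookup-distinct : ∀ {k v} (G : Hypergraph k v) {i j : Fin (e G)} → i ≢ j →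
  ∃[ u ] (u ∈ List.lookup (edges G) j × u ∉ List.lookup (edges G) i)
lookup-distinct {k} {v} G {i} {j} i≢j with any? (λ u → (u ∈? eⱼ) ×-dec ¬? (u ∈? eᵢ))
  where
  eᵢ eⱼ : Subset v
  eᵢ = List.lookup (edges G) i
  eⱼ = List.lookup (edges G) j
... | yes found = found
... | no none = ⊥-elim (i≢j (sym (unique-lookup-injective (distinct G) j i (p⊆q∧∣q∣≤∣p∣⇒p≡q sub (≤-reflexive
        (trans (All.lookup (uniform G) (∈-lookup i)) (sym (All.lookup (uniform G) (∈-lookup j)))))))))
  where
  eᵢ eⱼ : Subset v
  eᵢ = List.lookup (edges G) i
  eⱼ = List.lookup (edges G) j
  sub : ∀ {u} → u ∈ eⱼ → u ∈ eᵢ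
  sub {u} u∈ with u ∈? eᵢ
  ... | yes u∈ᵢ = u∈ᵢ
  ... | no u∉   = ⊥-elim (none (u , u∈ , u∉))

module _ {k vF n : ℕ} {F : Hypergraph k vF} (R : Packing F n) where

  packedEdge : Fin (count R) × Subset vF → Subset n
  packedEdge (i , t) = img (copy R i) t

  packedEdges : List (Subset n)
  packedEdges = map packedEdge (cartesianProduct (allFin (count R)) (edges F))

  packed-injective : ∀ {i j s t} → s LM.∈ edges F → t LM.∈ edges F →
    img (copy R i) s ≡ img (copy R j) t → (i , s) ≡ (j , t)
  packed-injective {i} {j} s∈ t∈ eq with i ≟ᶠ j
  ... | yes refl = cong (i ,_) (img-injective (copy R i) (copyInj R i) eq)
  ... | no i≢j   = ⊥-elim (disjoint R i j i≢j s∈ t∈ eq)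

  ∈-packedEdges⁻ : ∀ {s} → s LM.∈ packedEdges → ∃[ i ] ∃[ t ] (t LM.∈ edges F × s ≡ img (copy R i) t)
  ∈-packedEdges⁻ s∈ with ∈-map⁻ packedEdge s∈
  ... | (i , t) , it∈ , eq = i , t , proj₂ (∈-cartesianProduct⁻ (allFin (count R)) (edges F) it∈) , eq

  union : Hypergraph k n
  union .edges    = packedEdges
  union .uniform  = All.tabulate λ s∈ → size (∈-packedEdges⁻ s∈)
    where
    size : ∀ {s} → ∃[ i ] ∃[ t ] (t LM.∈ edges F × s ≡ img (copy R i) t) → ∣ s ∣ ≡ k
    size (i , t , t∈ , refl) = trans (∣img∣-injective (copy R i) (copyInj R i) t) (All.lookup (uniform F) t∈)
  union .distinct = injective-on⇒unique-map packedEdge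
    (Uniqueₚ.cartesianProduct⁺ (Uniqueₚ.allFin⁺ (count R)) (distinct F))
    (λ p∈ q∈ → packed-injective (snd∈ p∈) (snd∈ q∈))
    where
    snd∈ : ∀ {i t} → (i , t) LM.∈ cartesianProduct (allFin (count R)) (edges F) → t LM.∈ edges F
    snd∈ p∈ = proj₂ (∈-cartesianProduct⁻ (allFin (count R)) (edges F) p∈)

  e-union : e union ≡ count R * e F
  e-union = trans (LP.length-map packedEdge (cartesianProduct (allFin (count R)) (edges F)))
    (trans (length-cartesianProduct (allFin (count R)) (edges F)) (cong (_* e F) (length-allFin {count R})))

module _ {k vF vG n : ℕ} {F : Hypergraph k vF} (R : Packing F n) (G : Hypergraph k vG) (M : ℕ) where

  private
    D = vG + M

    α : Fin vG → Fin D
    α u = u ↑ˡ M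

    edge : Fin (e G) → Subset vG
    edge = List.lookup (edges G)

    Label : Set
    Label = (Fin vG × Fin vG) ⊎ (Fin (e G) × Fin vG)

    pairs : List (Fin vG × Fin vG)
    pairs = cartesianProduct (allFin vG) (allFin vG)

    flags : List (Fin (e G) × Fin vG)
    flags = cartesianProduct (allFin (e G)) (allFin vG)

    labels : List Label
    labels = map inj₁ pairs ++ map inj₂ flags

    coord : Label → Fin D
    coord (inj₁ (u , _)) = α u
    coord (inj₂ (_ , u)) = α u

    -- The first kind of defect is a non-injectivity; the second is a vertex outside
    -- the i-th edge which is mapped into the F-copy containing the image of that edge.
    Defect : Label → Vec (Fin n) D → Set
    Defect (inj₁ (u , v)) z = u ≢ v × lookup z (α u) ≡ lookup z (α v)
    Defect (inj₂ (i , u)) z = u ∉ edge i × ∃[ c ]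
      (img (lookup z ∘ α) (edge i) LM.∈ map (img (copy R c)) (edges F) × ∃[ y ] lookup z (α u) ≡ copy R c y)

    defect? : ∀ l → Decidable (Defect l)
    defect? (inj₁ (u , v)) z = ¬? (u ≟ᶠ v) ×-dec lookup z (α u) ≟ᶠ lookup z (α v)
    defect? (inj₂ (i , u)) z = ¬? (u ∈? edge i) ×-dec any? λ c →
      (img (lookup z ∘ α) (edge i) ∈ˢ? map (img (copy R c)) (edges F)) ×-dec any? λ y → lookup z (α u) ≟ᶠ copy R c y

    ∈-labels₂ : ∀ i u → inj₂ (i , u) LM.∈ labels
    ∈-labels₂ i u = ∈-++⁺ʳ (map inj₁ pairs) (∈-map⁺ inj₂ (∈-cartesianProduct⁺ (∈-allFin i) (∈-allFin u)))

    -- An injective homomorphism whose edges have distinct colours would be a rainbow copy.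
    -- Otherwise two edges `i` and `j` lie in the same `F`-copy, and a vertex of `j` outside `i` is
    -- a defect of the second kind.
    cover : ¬ Rainbow G R → ∀ z → IsHom G (union R) α z → ∃[ l ] (l LM.∈ labels × Defect l z)
    cover ¬rainbow z hom with collision-or-injective (lookup z ∘ α)
    ... | inj₁ (u , v , u≢v , eq) =
          inj₁ (u , v) , ∈-++⁺ˡ (∈-map⁺ inj₁ (∈-cartesianProduct⁺ (∈-allFin u) (∈-allFin v))) , u≢v , eq
    ... | inj₂ inj = clash (collision-or-injective colour)
      where
      origin : ∀ i → ∃[ c ] ∃[ t ] (t LM.∈ edges F × img (lookup z ∘ α) (edge i) ≡ img (copy R c) t)
      origin i = ∈-packedEdges⁻ R (All.lookup hom (∈-lookup i))
      colour : Fin (e G) → Fin (count R)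
      colour i = proj₁ (origin i)
      clash : (∃[ i ] ∃[ j ] (i ≢ j × colour i ≡ colour j)) ⊎ Injective _≡_ _≡_ colour → _
      clash (inj₂ colour-inj) = ⊥-elim (¬rainbow (record
        { ψ = lookup z ∘ α ; ψInj = inj ; col = colour ; colInj = colour-inj
        ; fits = λ i → proj₂ (origin i) }))
      clash (inj₁ (i , j , i≢j , same)) = found (lookup-distinct G i≢j) (proj₂ (origin i)) (proj₂ (origin j))
        where
        Origin : Fin (e G) → Fin (count R) → Set
        Origin i c = ∃[ t ] (t LM.∈ edges F × img (lookup z ∘ α) (edge i) ≡ img (copy R c) t)
        found : ∃[ u ] (u ∈ edge j × u ∉ edge i) → Origin i (colour i) → Origin j (colour j) →
                ∃[ l ] (l LM.∈ labels × Defect l z)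
        found (u , u∈ , u∉) (t , t∈ , eq) (t′ , t∈′ , eq′)
          with ∈-img⁻ (copy R (colour j)) t′ (subst (lookup z (α u) ∈_) eq′ (∈-img⁺ (lookup z ∘ α) u∈))
        ... | y , _ , y-eq = inj₂ (i , u) , ∈-labels₂ i u , u∉ , colour i ,
          subst (LM._∈ map (img (copy R (colour i))) (edges F)) (sym eq) (∈-map⁺ (img (copy R (colour i))) t∈) ,
          y , trans y-eq (cong (λ c → copy R c y) (sym same))

    -- A collision leaves one value for the image of `u`. In the second kind, `u` lies outside the
    -- edge `i`, so changing its image does not move the image of that edge; by edge-disjointness
    -- this image determines the copy, whose `vF` vertices are the only possible values. The bound
    -- `suc vF` serves both kinds.
    few-defects : ∀ l z → ∑ (allFin n) (λ x → 𝟙 (defect? l (z [ coord l ]≔ x))) ≤ suc vF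
    few-defects (inj₁ (u , v)) z = ≤-trans
      (∑-allFin-𝟙-confined (λ x → defect? (inj₁ (u , v)) (z [ α u ]≔ x)) (lookup z (α v) ∷ [])
        λ {x} (u≢v , eq) → here (trans (sym (lookup∘update (α u) z x))
          (trans eq (lookup∘update′ (λ q → u≢v (sym (↑ˡ-injective M v u q))) z x))))
      (s≤s z≤n)
    few-defects (inj₂ (i , u)) z = confine (any? (λ c → img (lookup z ∘ α) (edge i) ∈ˢ? map (img (copy R c)) (edges F)))
      where
      unchanged : ∀ x → u ∉ edge i → img (lookup (z [ α u ]≔ x) ∘ α) (edge i) ≡ img (lookup z ∘ α) (edge i)
      unchanged x u∉ = img-cong (edge i) λ {w} w∈ →
        lookup∘update′ (λ q → u∉ (subst (_∈ edge i) (↑ˡ-injective M w u q) w∈)) z x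
      confine : Dec (∃[ c ] img (lookup z ∘ α) (edge i) LM.∈ map (img (copy R c)) (edges F)) →
        ∑ (allFin n) (λ x → 𝟙 (defect? (inj₂ (i , u)) (z [ α u ]≔ x))) ≤ suc vF
      confine (no none) = ≤-trans (∑-allFin-𝟙-confined (λ x → defect? (inj₂ (i , u)) (z [ α u ]≔ x)) []
        λ {x} (u∉ , c , c∈ , _) → ⊥-elim (none (c , subst (LM._∈ map (img (copy R c)) (edges F)) (unchanged x u∉) c∈))) z≤n
      confine (yes (c , c∈)) = ≤-trans
        (∑-allFin-𝟙-confined (λ x → defect? (inj₂ (i , u)) (z [ α u ]≔ x)) (map (copy R c) (allFin vF)) inside)
        (≤-trans (≤-reflexive (trans (LP.length-map (copy R c) (allFin vF)) length-allFin)) (n≤1+n vF))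
        where
        inside : ∀ {x} → Defect (inj₂ (i , u)) (z [ α u ]≔ x) → x LM.∈ map (copy R c) (allFin vF)
        inside {x} (u∉ , c′ , c∈′ , y , eq)
          with ∈-map⁻ (img (copy R c)) c∈ | ∈-map⁻ (img (copy R c′)) c∈′
        ... | t , t∈ , q | t′ , t∈′ , q′
          with packed-injective R {c} {c′} t∈ t∈′ (trans (sym q) (trans (sym (unchanged x u∉)) q′))
        ... | refl = subst (LM._∈ map (copy R c) (allFin vF)) (trans (sym eq) (lookup∘update (α u) z x))
                       (∈-map⁺ (copy R c) (∈-allFin y))

  defectBound : ℕ
  defectBound = (vG * vG + e G * vG) * suc vF

  rainbow-free⇒few-homs : ¬ Rainbow G R → n * #hom G (union R) (λ u → u ↑ˡ M) ≤ defectBound * n ^ (vG + M)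
  rainbow-free⇒few-homs ¬rainbow = subst (λ t → n * #hom G (union R) α ≤ t * suc vF * n ^ D) length-labels
    (count-covered labels (suc vF) coord (isHom? G (union R) α) defect? (cover ¬rainbow) few-defects)
    where
    length-labels : length labels ≡ vG * vG + e G * vG
    length-labels = trans (LP.length-++ (map inj₁ pairs)) (cong₂ _+_
      (trans (LP.length-map inj₁ pairs) (length-pairs vG vG))
      (trans (LP.length-map inj₂ flags) (length-pairs (e G) vG)))

-- Greedy packings

injective? : ∀ {m n} (f : Fin m → Fin n) → Dec (Injective _≡_ _≡_ f)
injective? f with collision-or-injective f
... | inj₁ (i , j , i≢j , eq) = no (λ inj → i≢j (inj eq))
... | inj₂ inj = yes inj

copy? : ∀ {k vG n} (G : Hypergraph k vG) (H : Hypergraph k n) → Dec (Copy G H)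
copy? {vG = vG} {n} G H = map′ from to
  (Any.any? (λ z → injective? (lookup z) ×-dec All.all? (λ s → img (lookup z) s ∈ˢ? edges H) (edges G)) (vecs n vG))
  where
  IsCopy : Vec (Fin n) vG → Set
  IsCopy z = Injective _≡_ _≡_ (lookup z) × All (λ s → img (lookup z) s LM.∈ edges H) (edges G)
  from : Any.Any IsCopy (vecs n vG) → Copy G H
  from found with LM.find found
  ... | z , _ , inj , hom = lookup z , inj , hom
  to : Copy G H → Any.Any IsCopy (vecs n vG)
  to (φ , inj , hom) = LM.lose (∈-vecs (Vec.tabulate φ))
    ( (λ {x} {y} eq → inj (trans (sym (lookup∘tabulate φ x)) (trans eq (lookup∘tabulate φ y))))
    , All.map (λ {s} → subst (LM._∈ edges H) (img-cong s (λ {x} _ → sym (lookup∘tabulate φ x)))) hom)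

module _ {k vF n : ℕ} (F : Hypergraph k vF) where

  _Within_ : Packing F n → Hypergraph k n → Set
  R Within H = ∀ i {t} → t LM.∈ edges F → img (copy R i) t LM.∈ edges H

  module _ (H : Hypergraph k n) (φ : Fin vF → Fin n) where

    used : List (Subset n)
    used = map (img φ) (edges F)

    remove : Hypergraph k n
    remove .edges    = filter (λ s → ¬? (s ∈ˢ? used)) (edges H)
    remove .uniform  = Allₚ.filter⁺ _ (uniform H)
    remove .distinct = Uniqueₚ.filter⁺ _ (distinct H)

    e-remove-≤ : e H ≤ e F + e remove
    e-remove-≤ = begin
      e H                                    ≡⟨ sym (trans (∑-const (edges H) 1) (*-identityʳ _)) ⟩
      ∑ (edges H) (λ _ → 1)                  ≤⟨ ∑-mono (edges H) (λ s → excluded-middle (s ∈ˢ? used)) ⟩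
      ∑ (edges H) (λ s → 𝟙 (s ∈ˢ? used) + 𝟙 (¬? (s ∈ˢ? used)))
                                             ≡⟨ ∑-+ (edges H) _ _ ⟩
      ∑ (edges H) (λ s → 𝟙 (s ∈ˢ? used)) + ∑ (edges H) (λ s → 𝟙 (¬? (s ∈ˢ? used)))
                                             ≤⟨ +-mono-≤ (∑-𝟙-confined _≟ˢ_ (distinct H) (_∈ˢ? used) used id)
                                                         (≤-reflexive (∑-𝟙-filter (λ s → ¬? (s ∈ˢ? used)) (edges H))) ⟩
      length used + e remove                 ≡⟨ cong (_+ e remove) (LP.length-map (img φ) (edges F)) ⟩
      e F + e remove                         ∎
      where
      open ≤-Reasoning
      excluded-middle : ∀ {P : Set} (d : Dec P) → 1 ≤ 𝟙 d + 𝟙 (¬? d)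
      excluded-middle (yes _) = ≤-refl
      excluded-middle (no _)  = ≤-refl

    -- An edge of `F` exists and its image is deleted; this makes the fuel of `greedy` sufficient.
    e-remove-< : 1 ≤ e F → All (λ s → img φ s LM.∈ edges H) (edges F) → e remove < e H
    e-remove-< 1≤eF hom = LP.filter-notAll _ (edges H)
      (LM.lose (All.lookup hom (∈-lookup i)) (λ ¬used → ¬used (∈-map⁺ (img φ) (∈-lookup i))))
      where
      i : Fin (e F)
      i = fromℕ< 1≤eF

    addCopy : Injective _≡_ _≡_ φ → (R : Packing F n) → R Within remove → Packing F n
    addCopy inj R within = record { count = suc (count R) ; copy = copy′ ; copyInj = copyInj′ ; disjoint = disjoint′ }
      where
      copy′ : Fin (suc (count R)) → Fin vF → Fin n
      copy′ zero    = φ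
      copy′ (suc i) = copy R i
      copyInj′ : ∀ i → Injective _≡_ _≡_ (copy′ i)
      copyInj′ zero    = inj
      copyInj′ (suc i) = copyInj R i
      unused : ∀ i {s t} → s LM.∈ edges F → t LM.∈ edges F → img φ s ≢ img (copy R i) t
      unused i s∈ t∈ eq = proj₂ (∈-filter⁻ (λ s → ¬? (s ∈ˢ? used)) {xs = edges H} (within i t∈))
        (subst (LM._∈ used) eq (∈-map⁺ (img φ) s∈))
      disjoint′ : ∀ i j → i ≢ j → ∀ {s t} → s LM.∈ edges F → t LM.∈ edges F → img (copy′ i) s ≢ img (copy′ j) t
      disjoint′ zero    zero    0≢0 _  _  _  = 0≢0 refl
      disjoint′ zero    (suc j) _   s∈ t∈ eq = unused j s∈ t∈ eq
      disjoint′ (suc i) zero    _   s∈ t∈ eq = unused i t∈ s∈ (sym eq)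
      disjoint′ (suc i) (suc j) i≢j s∈ t∈ eq = disjoint R i j (i≢j ∘ cong suc) s∈ t∈ eq

  emptyPacking : Packing F n
  emptyPacking = record { count = 0 ; copy = λ () ; copyInj = λ () ; disjoint = λ () }

  -- Copies of `F` are removed as long as there are any. What remains is `F`-free, so at most
  -- `W / p` edges are left uncovered. The recursion is on `fuel`, a bound for the number of edges.
  greedy : ∀ p W → 1 ≤ e F → (∀ H → ¬ Copy F H → p * e H ≤ W) → ∀ fuel (H : Hypergraph k n) → e H ≤ fuel →
    ∃[ R ] (R Within H × p * e H ≤ p * (count R * e F) + W)
  greedy p W 1≤eF sparse fuel H enough with copy? F H
  greedy p W 1≤eF sparse fuel H enough | no free =
    emptyPacking , (λ ()) , ≤-trans (sparse H free) (m≤n+m W (p * 0))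
  greedy p W 1≤eF sparse zero H enough | yes (φ , inj , hom) =
    ⊥-elim (n≮0 (≤-trans (e-remove-< H φ 1≤eF hom) enough))
  greedy p W 1≤eF sparse (suc fuel) H enough | yes (φ , inj , hom)
    with greedy p W 1≤eF sparse fuel (remove H φ) (≤-pred (≤-trans (e-remove-< H φ 1≤eF hom) enough))
  ... | R , within , bound = addCopy H φ inj R within , within′ , bound′
    where
    within′ : addCopy H φ inj R within Within H
    within′ zero    t∈ = All.lookup hom t∈
    within′ (suc i) t∈ = proj₁ (∈-filter⁻ (λ s → ¬? (s ∈ˢ? used H φ)) {xs = edges H} (within i t∈))
    bound′ : p * e H ≤ p * (suc (count R) * e F) + W
    bound′ = begin
      p * e H                                  ≤⟨ *-monoʳ-≤ p (e-remove-≤ H φ) ⟩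
      p * (e F + e (remove H φ))               ≡⟨ *-distribˡ-+ p (e F) _ ⟩
      p * e F + p * e (remove H φ)             ≤⟨ +-monoʳ-≤ (p * e F) bound ⟩
      p * e F + (p * (count R * e F) + W)      ≡⟨ regroup p (e F) (count R) W ⟩
      p * (suc (count R) * e F) + W            ∎
      where
      open ≤-Reasoning
      regroup : ∀ p a c W → p * a + (p * (c * a) + W) ≡ p * (suc c * a) + W
      regroup = solve-∀

within-free⇒rainbow-free : ∀ {k vF vG n} {F : Hypergraph k vF} (G : Hypergraph k vG) (H : Hypergraph k n) (R : Packing F n) →
  (_Within_ F R H) → ¬ Copy G H → ¬ Rainbow G R
within-free⇒rainbow-free G H R within free rainbow = free (ψ , ψInj , All.tabulate edge)
  where
  open Rainbow rainbow
  edge : ∀ {s} → s LM.∈ edges G → img ψ s LM.∈ edges H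
  edge s∈ with fits (Any.index s∈)
  ... | t , t∈ , eq = subst (λ s → img ψ s LM.∈ edges H) (sym (Anyₚ.lookup-index s∈))
                        (subst (LM._∈ edges H) (sym eq) (within (col (Any.index s∈)) t∈))

-- Random blow-ups

unique-vecs : ∀ n D → Unique (vecs n D)
unique-vecs n zero    = [] ∷ []
unique-vecs n (suc D) = Uniqueₚ.cartesianProductWith⁺ _∷_ ∷-injective (Uniqueₚ.allFin⁺ n) (unique-vecs n D)

module _ {k n : ℕ} (H : Hypergraph k n) (h : Fin n → Fin n) where
  open OrderedEdges H

  liftable? : Decidable (λ (ρ : Vec (Fin n) k) → Vec.map h ρ LM.∈ O)
  liftable? ρ = Vec.map h ρ ∈ᵛ? O

  -- Only the chosen order of each edge of `H` is lifted, so an edge of `pullback` comes from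
  -- exactly one tuple and edges can be counted as tuples.
  pullbackEdges : List (Vec (Fin n) k)
  pullbackEdges = filter liftable? (vecs n k)

  private
    lifts : ∀ {ρ} → ρ LM.∈ pullbackEdges → Vec.map h ρ LM.∈ O
    lifts ρ∈ = proj₂ (∈-filter⁻ liftable? {xs = vecs n k} ρ∈)

    img-vset∈ : ∀ {ρ} → ρ LM.∈ pullbackEdges → img h (vset ρ) LM.∈ edges H
    img-vset∈ {ρ} ρ∈ = subst (LM._∈ edges H) (vset-map h ρ) (vset∈ (lifts ρ∈))

    -- The image under `h` already has `k` elements, so the tuple has no repeated entry.
    size : ∀ {ρ} → ρ LM.∈ pullbackEdges → ∣ vset ρ ∣ ≡ k
    size {ρ} ρ∈ = ≤-antisym
      (≤-trans (∣img∣≤ (lookup ρ) ⊤) (≤-reflexive (∣⊤∣≡n k)))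
      (≤-trans (≤-reflexive (sym (All.lookup (uniform H) (img-vset∈ ρ∈)))) (∣img∣≤ h (vset ρ)))

    -- Equal vertex sets have the same image under h, hence the same ordered image,
    -- and h is injective on the edge.
    vset-injective : ∀ {ρ σ} → ρ LM.∈ pullbackEdges → σ LM.∈ pullbackEdges → vset ρ ≡ vset σ → ρ ≡ σ
    vset-injective {ρ} {σ} ρ∈ σ∈ eq = vec-ext same
      where
      image≡ : Vec.map h ρ ≡ Vec.map h σ
      image≡ = unique-map-injective vset unique-vset-O (lifts ρ∈) (lifts σ∈)
        (trans (vset-map h ρ) (trans (cong (img h) eq) (sym (vset-map h σ))))
      same : ∀ i → lookup ρ i ≡ lookup σ i
      same i with ∈-img⁻ (lookup σ) ⊤ (subst (lookup ρ i ∈_) eq (∈-img⁺ (lookup ρ) ∈⊤))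
      ... | j , _ , ρᵢ≡σⱼ = trans ρᵢ≡σⱼ (cong (lookup σ) (sym (O-injective (lifts ρ∈) (begin
        lookup (Vec.map h ρ) i   ≡⟨ lookup-map i h ρ ⟩
        h (lookup ρ i)           ≡⟨ cong h ρᵢ≡σⱼ ⟩
        h (lookup σ j)           ≡⟨ sym (lookup-map j h σ) ⟩
        lookup (Vec.map h σ) j   ≡⟨ cong (λ v → lookup v j) (sym image≡) ⟩
        lookup (Vec.map h ρ) j   ∎))))
        where open ≡-Reasoning

  pullback : Hypergraph k n
  pullback .edges    = map vset pullbackEdges
  pullback .uniform  = Allₚ.map⁺ (All.tabulate size)
  pullback .distinct = injective-on⇒unique-map vset (Uniqueₚ.filter⁺ liftable? (unique-vecs n k)) vset-injective

  e-pullback : e pullback ≡ ∑ (vecs n k) (λ ρ → 𝟙 (Vec.map h ρ ∈ᵛ? O))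
  e-pullback = trans (LP.length-map vset pullbackEdges) (sym (∑-𝟙-filter liftable? (vecs n k)))

  ∈-pullback⁻ : ∀ {s} → s LM.∈ edges pullback → img h s LM.∈ edges H
  ∈-pullback⁻ s∈ with ∈-map⁻ vset s∈
  ... | ρ , ρ∈ , refl = img-vset∈ ρ∈

-- The map `g` splits the vertices into `M` blocks of at most `q` vertices, and the coordinate
-- `vG ↑ʳ j` of a random `z` is the vertex of `H` representing block `j`. The first `vG` coordinates
-- are idle here; they are kept so that the counts match those in `few`.
module Sampling {k vG n M : ℕ} (G : Hypergraph k vG) (H : Hypergraph k n) (1≤n : 1 ≤ n)
  (g : Fin n → Fin M) (q : ℕ) (fibre : ∀ (j : Fin M) → ∑ (allFin n) (λ x → 𝟙 (g x ≟ᶠ j)) ≤ q)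
  (p : ℕ) (few : ∀ (φ : Fin vG → Fin M) → p * #hom G H (λ u → vG ↑ʳ φ u) ≤ n ^ (vG + M))
  (X : ℕ) (extremal : ∀ (H′ : Hypergraph k n) → ¬ Copy G H′ → e H′ ≤ X) where
  open OrderedEdges H

  private
    D = vG + M
    W = n ^ D
    Ω = vecs n D

    blowup : Vec (Fin n) D → Fin n → Fin n
    blowup z x = lookup z (vG ↑ʳ g x)

    -- The sample is bad if some assignment of blocks to the vertices of `G` induces a homomorphism
    -- to `H`. There are `M ^ vG` assignments, which leads to a union bound.
    Bad : Vec (Fin n) D → Set
    Bad z = Any.Any (λ φ → IsHom G H (λ u → vG ↑ʳ lookup φ u) z) (vecs M vG)

    bad? : Decidable Bad
    bad? z = Any.any? (λ φ → isHom? G H (λ u → vG ↑ʳ lookup φ u) z) (vecs M vG)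

    #bad : ℕ
    #bad = ∑ Ω (λ z → 𝟙 (bad? z))

    #bad-small : p * #bad ≤ M ^ vG * W
    #bad-small = begin
      p * #bad                                            ≤⟨ *-monoʳ-≤ p (∑-mono Ω (λ z → 𝟙-elim (bad? z) (witness z))) ⟩
      p * ∑ Ω (λ z → ∑ Φ (λ φ → 𝟙 (hom? φ z)))            ≡⟨ trans (cong (p *_) (∑-swap Ω Φ _)) (sym (∑-*ˡ Φ p _)) ⟩
      ∑ Φ (λ φ → p * ∑ Ω (λ z → 𝟙 (hom? φ z)))            ≤⟨ ∑-bound Φ (λ φ → few (lookup φ)) ⟩
      length Φ * W                                        ≡⟨ cong (_* W) (length-vecs vG) ⟩
      M ^ vG * W                                          ∎
      where
      open ≤-Reasoning
      Φ = vecs M vG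
      hom? : ∀ φ → Decidable (IsHom G H (λ u → vG ↑ʳ lookup φ u))
      hom? φ = isHom? G H (λ u → vG ↑ʳ lookup φ u)
      witness : ∀ z → Bad z → 1 ≤ ∑ Φ (λ φ → 𝟙 (hom? φ z))
      witness z bad with LM.find bad
      ... | φ , φ∈ , hom = ≤-trans (≤-reflexive (sym (𝟙-yes (hom? φ z) hom))) (∑-member (λ φ → 𝟙 (hom? φ z)) φ∈)

    -- A copy of `G` in the blow-up, composed with `g`, is an assignment of blocks that makes the
    -- sample bad.
    good⇒free : ∀ z → ¬ Bad z → ¬ Copy G (pullback H (blowup z))
    good⇒free z ¬bad (ψ , _ , copies) = ¬bad (LM.lose (∈-vecs φ) (All.map hom copies))
      where
      φ = Vec.tabulate (g ∘ ψ)
      hom : ∀ {s} → img ψ s LM.∈ edges (pullback H (blowup z)) → img (λ u → lookup z (vG ↑ʳ lookup φ u)) s LM.∈ edges H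
      hom {s} s∈ = subst (LM._∈ edges H)
        (trans (img-∘ (blowup z) ψ s) (img-cong s (λ {u} _ → cong (λ w → lookup z (vG ↑ʳ w)) (sym (lookup∘tabulate (g ∘ ψ) u)))))
        (∈-pullback⁻ H (blowup z) s∈)

    -- Good samples are bounded by the extremal number `X`, and bad ones only by the number of all
    -- tuples.
    e-pullback-≤ : ∀ z → e (pullback H (blowup z)) ≤ X + 𝟙 (bad? z) * n ^ k
    e-pullback-≤ z with bad? z
    ... | no ¬bad = ≤-trans (extremal (pullback H (blowup z)) (good⇒free z ¬bad)) (m≤m+n X 0)
    ... | yes _   = begin
      e (pullback H (blowup z))   ≡⟨ e-pullback H (blowup z) ⟩
      ∑ (vecs n k) (λ ρ → 𝟙 (Vec.map (blowup z) ρ ∈ᵛ? O))  ≤⟨ ∑-mono (vecs n k) (λ ρ → 𝟙≤1 (Vec.map (blowup z) ρ ∈ᵛ? O)) ⟩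
      ∑ (vecs n k) (λ _ → 1)      ≡⟨ trans (∑-vecs-const k 1) (*-comm (n ^ k) 1) ⟩
      1 * n ^ k                   ≤⟨ m≤n+m (1 * n ^ k) X ⟩
      X + 1 * n ^ k               ∎
      where open ≤-Reasoning

    total-≤ : ∑ Ω (λ z → e (pullback H (blowup z))) ≤ W * X + #bad * n ^ k
    total-≤ = ≤-trans (∑-mono Ω e-pullback-≤) (≤-reflexive
      (trans (∑-+ Ω (λ _ → X) _) (cong₂ _+_ (∑-vecs-const D X) (∑-*ʳ Ω (n ^ k) _))))

    transversal? : ∀ (ρ : Vec (Fin n) k) → Dec (Injective _≡_ _≡_ (g ∘ lookup ρ))
    transversal? ρ = injective? (g ∘ lookup ρ)

    -- Tuples whose entries lie in distinct blocks, and tuples with two entries in a common block.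
    #straight #folded : ℕ
    #straight = ∑ (vecs n k) (λ ρ → 𝟙 (transversal? ρ))
    #folded = ∑ (vecs n k) (λ ρ → 𝟙 (¬? (transversal? ρ)))

    #all : #straight + #folded ≡ n ^ k
    #all = trans (sym (∑-+ (vecs n k) _ _)) (trans (∑-cong (vecs n k) (λ ρ → complement (transversal? ρ)))
      (trans (∑-vecs-const k 1) (*-identityʳ _)))
      where
      complement : ∀ {P : Set} (d : Dec P) → 𝟙 d + 𝟙 (¬? d) ≡ 1
      complement (yes _) = refl
      complement (no _)  = refl

    -- The entries of a straight tuple are sent to `k` distinct, hence independent, coordinates of
    -- `z`, so it becomes an edge with probability at least `e H / n ^ k`. Folded tuples are
    -- dropped.
    total-≥ : e H * W * #straight ≤ n ^ k * ∑ Ω (λ z → e (pullback H (blowup z)))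
    total-≥ = begin
      e H * W * #straight                                              ≡⟨ sym (∑-*ˡ (vecs n k) (e H * W) _) ⟩
      ∑ (vecs n k) (λ ρ → e H * W * 𝟙 (transversal? ρ))        ≤⟨ ∑-mono (vecs n k) perTuple ⟩
      ∑ (vecs n k) (λ ρ → n ^ k * ∑ Ω (λ z → 𝟙 (Vec.map (blowup z) ρ ∈ᵛ? O)))
                                                               ≡⟨ trans (∑-*ˡ (vecs n k) (n ^ k) _) (cong (n ^ k *_) (∑-swap (vecs n k) Ω _)) ⟩
      n ^ k * ∑ Ω (λ z → ∑ (vecs n k) (λ ρ → 𝟙 (Vec.map (blowup z) ρ ∈ᵛ? O)))
                                                               ≡⟨ cong (n ^ k *_) (∑-cong Ω (λ z → sym (e-pullback H (blowup z)))) ⟩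
      n ^ k * ∑ Ω (λ z → e (pullback H (blowup z)))            ∎
      where
      open ≤-Reasoning
      perTuple : ∀ ρ → e H * W * 𝟙 (transversal? ρ) ≤ n ^ k * ∑ Ω (λ z → 𝟙 (Vec.map (blowup z) ρ ∈ᵛ? O))
      perTuple ρ with transversal? ρ
      ... | no _ = ≤-trans (≤-reflexive (*-zeroʳ (e H * W))) z≤n
      ... | yes inj = begin
        e H * W * 1                                                      ≡⟨ trans (*-identityʳ _) (cong (_* W) (sym length-O)) ⟩
        length O * W                                                     ≤⟨ prescribed-members β β-injective unique-O ⟩
        n ^ k * ∑ Ω (λ z → 𝟙 (Vec.map (lookup z) β ∈ᵛ? O))               ≡⟨ cong (n ^ k *_) (∑-cong Ω (λ z → cong (λ v → 𝟙 (v ∈ᵛ? O)) (sym (map-∘ (lookup z) (λ x → vG ↑ʳ g x) ρ)))) ⟩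
        n ^ k * ∑ Ω (λ z → 𝟙 (Vec.map (blowup z) ρ ∈ᵛ? O))               ∎
        where
        β = Vec.map (λ x → vG ↑ʳ g x) ρ
        β-injective : Injective _≡_ _≡_ (lookup β)
        β-injective {i} {j} eq = inj (↑ʳ-injective vG _ _
          (trans (sym (lookup-map i (λ x → vG ↑ʳ g x) ρ)) (trans eq (lookup-map j (λ x → vG ↑ʳ g x) ρ))))

    -- For each pair of positions, one entry is confined to the block of the other, which leaves at
    -- most `q` values.
    #folded-small : n * #folded ≤ k * k * q * n ^ k
    #folded-small = subst (λ t → n * #folded ≤ t * q * n ^ k) (length-pairs k k)
      (count-covered labels q proj₁ (λ ρ → ¬? (transversal? ρ)) collide? cover few-collisions)
      where
      labels = cartesianProduct (allFin k) (allFin k)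
      Collide : Fin k × Fin k → Vec (Fin n) k → Set
      Collide (u , v) ρ = u ≢ v × g (lookup ρ u) ≡ g (lookup ρ v)
      collide? : ∀ l → Decidable (Collide l)
      collide? (u , v) ρ = ¬? (u ≟ᶠ v) ×-dec g (lookup ρ u) ≟ᶠ g (lookup ρ v)
      cover : ∀ ρ → ¬ Injective _≡_ _≡_ (g ∘ lookup ρ) → ∃[ l ] (l LM.∈ labels × Collide l ρ)
      cover ρ ¬inj with collision-or-injective (g ∘ lookup ρ)
      ... | inj₁ (u , v , u≢v , eq) = (u , v) , ∈-cartesianProduct⁺ (∈-allFin u) (∈-allFin v) , u≢v , eq
      ... | inj₂ inj = ⊥-elim (¬inj inj)
      few-collisions : ∀ l ρ → ∑ (allFin n) (λ x → 𝟙 (collide? l (ρ [ proj₁ l ]≔ x))) ≤ q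
      few-collisions (u , v) ρ = ≤-trans
        (∑-mono (allFin n) (λ x → 𝟙-mono (collide? (u , v) (ρ [ u ]≔ x)) (g x ≟ᶠ g (lookup ρ v))
          λ (u≢v , eq) → trans (cong g (sym (lookup∘update u ρ x)))
            (trans eq (cong g (lookup∘update′ (u≢v ∘ sym) ρ x)))))
        (fibre (g (lookup ρ v)))

  -- Divided by `n * p`, this is a comparison of the two estimates for the average size of the
  -- blow-up: `e H` exceeds `X` by at most `n ^ k` times the sum of `M ^ vG / p`, for bad samples,
  -- and `k * k * q / n`, for folded tuples.
  sampled-bound : n * (p * e H) ≤ n * (p * X) + n * (M ^ vG * n ^ k) + p * (k * k * q) * n ^ k
  sampled-bound = *-cancelˡ-≤-pos (*-mono-≤ (1≤n^ D) (1≤n^ k)) (begin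
    (W * n ^ k) * (n * (p * E))                         ≡⟨ cong (λ t → (W * t) * (n * (p * E))) (sym #all) ⟩
    (W * (#straight + #folded)) * (n * (p * E))                       ≡⟨ split W #straight #folded n p E ⟩
    (p * n) * (E * W * #straight) + (p * E * W) * (n * #folded)       ≤⟨ +-mono-≤ (*-monoʳ-≤ (p * n) total-≥) (*-mono-≤ (*-monoˡ-≤ W (*-monoʳ-≤ p E≤)) #folded-small) ⟩
    (p * n) * (K * Σₑ) + (p * K * W) * (k * k * q * K)  ≤⟨ +-monoˡ-≤ _ (*-monoʳ-≤ (p * n) (*-monoʳ-≤ K total-≤)) ⟩
    (p * n) * (K * (W * X + #bad * K)) + (p * K * W) * (k * k * q * K)
                                                        ≡⟨ gather p n K W X #bad (k * k * q) ⟩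
    (n * K) * (p * (W * X) + p * #bad * K) + (p * K * W) * (k * k * q * K)
                                                        ≤⟨ +-monoˡ-≤ _ (*-monoʳ-≤ (n * K) (+-monoʳ-≤ (p * (W * X)) (*-monoˡ-≤ K #bad-small))) ⟩
    (n * K) * (p * (W * X) + M ^ vG * W * K) + (p * K * W) * (k * k * q * K)
                                                        ≡⟨ finish p n K W X (M ^ vG) (k * k * q) ⟩
    (W * K) * (n * (p * X) + n * (M ^ vG * K) + p * (k * k * q) * K) ∎)
    where
    open ≤-Reasoning
    E = e H
    K = n ^ k
    Σₑ = ∑ Ω (λ z → e (pullback H (blowup z)))
    1≤n^ : ∀ d → 1 ≤ n ^ d
    1≤n^ d = m^n>0 n {{>-nonZero 1≤n}} d
    E≤ : E ≤ K
    E≤ = subst (_≤ K) length-O (members≤n^k 1≤n unique-O)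
    split : ∀ W a b n p E → (W * (a + b)) * (n * (p * E)) ≡ (p * n) * (E * W * a) + (p * E * W) * (n * b)
    split = solve-∀
    gather : ∀ p n K W X b c → (p * n) * (K * (W * X + b * K)) + (p * K * W) * (c * K) ≡
             (n * K) * (p * (W * X) + p * b * K) + (p * K * W) * (c * K)
    gather = solve-∀
    finish : ∀ p n K W X T c → (n * K) * (p * (W * X) + T * W * K) + (p * K * W) * (c * K) ≡
             (W * K) * (n * (p * X) + n * (T * K) + p * c * K)
    finish = solve-∀

-- Splitting the vertices into blocks

module Blocks (n M q : ℕ) {{_ : NonZero q}} (covers : n ≤ M * q) where

  block : Fin n → Fin M
  block x = fromℕ< (m<n*o⇒m/o<n (<-≤-trans (toℕ<n x) covers))

  block-fibre : ∀ j → ∑ (allFin n) (λ x → 𝟙 (block x ≟ᶠ j)) ≤ q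
  block-fibre j = begin
    ∑ (allFin n) (λ x → 𝟙 (block x ≟ᶠ j))             ≤⟨ ∑-mono (allFin n) (λ x → 𝟙-mono (block x ≟ᶠ j) (toℕ x / q ≟ toℕ j)
                                                           λ { refl → sym (toℕ-fromℕ< _) }) ⟩
    ∑ (allFin n) (λ x → 𝟙 (toℕ x / q ≟ toℕ j))        ≡⟨ sym (∑-map toℕ (allFin n) _) ⟩
    ∑ (map toℕ (allFin n)) (λ x → 𝟙 (x / q ≟ toℕ j))  ≤⟨ ∑-𝟙-confined _≟_ (Uniqueₚ.map⁺ toℕ-injective (Uniqueₚ.allFin⁺ n)) (λ x → x / q ≟ toℕ j) ys confined ⟩
    length ys                                         ≡⟨ trans (LP.length-map _ (upTo q)) (LP.length-upTo q) ⟩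
    q                                                 ∎
    where
    open ≤-Reasoning
    -- The numbers with quotient `toℕ j` are determined by their remainders modulo `q`.
    ys = map (λ r → r + toℕ j * q) (upTo q)
    confined : ∀ {x} → x / q ≡ toℕ j → x LM.∈ ys
    confined {x} eq = subst (LM._∈ ys) (sym (trans (m≡m%n+[m/n]*n x q) (cong (λ t → x % q + t * q) eq)))
      (∈-map⁺ _ (∈-upTo⁺ (m%n<n x q)))

-- Packings from polynomials

open import Data.Integer using (+_)

eval : ∀ {k} → ℤ → Vec ℤ k → ℤ
eval x []       = 0ℤ
eval x (c ∷ cs) = c ℤ.+ x ℤ.* eval x cs

eval-zipWith-- : ∀ {k} x (cs ds : Vec ℤ k) → eval x (Vec.zipWith ℤ._-_ cs ds) ≡ eval x cs ℤ.- eval x ds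
eval-zipWith-- x []       []       = refl
eval-zipWith-- x (c ∷ cs) (d ∷ ds) =
  trans (cong (λ t → (c ℤ.- d) ℤ.+ x ℤ.* t) (eval-zipWith-- x cs ds)) (regroup c d x (eval x cs) (eval x ds))
  where
  regroup : ∀ c d x a b → (c ℤ.- d) ℤ.+ x ℤ.* (a ℤ.- b) ≡ (c ℤ.+ x ℤ.* a) ℤ.- (d ℤ.+ x ℤ.* b)
  regroup = solveℤ-∀

-- The quotient of the division by X − r; coefficients are listed from the constant term on.
divideOut : ∀ {k} → ℤ → Vec ℤ (suc k) → Vec ℤ k
divideOut r (c ∷ [])     = []
divideOut r (c ∷ d ∷ ds) = eval r (d ∷ ds) ∷ divideOut r (d ∷ ds)

eval-divideOut : ∀ {k} x r (cs : Vec ℤ (suc k)) → eval x cs ℤ.- eval r cs ≡ (x ℤ.- r) ℤ.* eval x (divideOut r cs)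
eval-divideOut x r (c ∷ [])     = constant x r c
  where
  constant : ∀ x r c → (c ℤ.+ x ℤ.* 0ℤ) ℤ.- (c ℤ.+ r ℤ.* 0ℤ) ≡ (x ℤ.- r) ℤ.* 0ℤ
  constant = solveℤ-∀
eval-divideOut x r (c ∷ d ∷ ds) = begin
  (c ℤ.+ x ℤ.* Eₓ) ℤ.- (c ℤ.+ r ℤ.* Eᵣ)                ≡⟨ regroup c x r Eₓ Eᵣ ⟩
  (x ℤ.- r) ℤ.* Eᵣ ℤ.+ x ℤ.* (Eₓ ℤ.- Eᵣ)               ≡⟨ cong (λ t → (x ℤ.- r) ℤ.* Eᵣ ℤ.+ x ℤ.* t) (eval-divideOut x r (d ∷ ds)) ⟩
  (x ℤ.- r) ℤ.* Eᵣ ℤ.+ x ℤ.* ((x ℤ.- r) ℤ.* Q)         ≡⟨ regroup′ x r Eᵣ Q ⟩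
  (x ℤ.- r) ℤ.* (Eᵣ ℤ.+ x ℤ.* Q)                       ∎
  where
  open ≡-Reasoning
  Eₓ = eval x (d ∷ ds)
  Eᵣ = eval r (d ∷ ds)
  Q = eval x (divideOut r (d ∷ ds))
  regroup : ∀ c x r a b → (c ℤ.+ x ℤ.* a) ℤ.- (c ℤ.+ r ℤ.* b) ≡ (x ℤ.- r) ℤ.* b ℤ.+ x ℤ.* (a ℤ.- b)
  regroup = solveℤ-∀
  regroup′ : ∀ x r b q → (x ℤ.- r) ℤ.* b ℤ.+ x ℤ.* ((x ℤ.- r) ℤ.* q) ≡ (x ℤ.- r) ℤ.* (b ℤ.+ x ℤ.* q)
  regroup′ = solveℤ-∀

-- Synthetic division read backwards: the first coefficient of the quotient is the value at `r` of
-- the tail, so `c` is the value of the whole polynomial minus `r` times that coefficient.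
divideOut-divisible : ∀ {k} m r (cs : Vec ℤ (suc k)) → m ∣ℤ eval r cs → (∀ i → m ∣ℤ lookup (divideOut r cs) i) →
  ∀ i → m ∣ℤ lookup cs i
divideOut-divisible m r (c ∷ []) m∣ div zero = subst (m ∣ℤ_) (constant c r) m∣
  where
  constant : ∀ c r → c ℤ.+ r ℤ.* 0ℤ ≡ c
  constant = solveℤ-∀
divideOut-divisible m r (c ∷ d ∷ ds) m∣ div zero =
  subst (m ∣ℤ_) (cancel c (r ℤ.* eval r (d ∷ ds))) (∣m∣n⇒∣m-n m∣ (∣n⇒∣m*n r (div zero)))
  where
  cancel : ∀ c a → (c ℤ.+ a) ℤ.- a ≡ c
  cancel = solveℤ-∀
divideOut-divisible m r (c ∷ d ∷ ds) m∣ div (suc i) = divideOut-divisible m r (d ∷ ds) (div zero) (div ∘ suc) i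

-- This says that `δ` is not a zero divisor modulo `m`.
Cancellable : ℤ → ℤ → Set
Cancellable m δ = ∀ y → m ∣ℤ δ ℤ.* y → m ∣ℤ y

-- A polynomial of degree below `k` with `k` roots is zero, also over a ring with zero divisors if
-- the differences of the roots can be cancelled: after dividing out the first root, the quotient
-- still vanishes at the others.
vanishing⇒zero : ∀ {k} m (x : Fin k → ℤ) → (∀ {i j} → i ≢ j → Cancellable m (x i ℤ.- x j)) →
  (cs : Vec ℤ k) → (∀ i → m ∣ℤ eval (x i) cs) → ∀ i → m ∣ℤ lookup cs i
vanishing⇒zero {suc k} m x cancel cs zeros = divideOut-divisible m (x zero) cs (zeros zero)
  (vanishing⇒zero m (x ∘ suc) (λ i≢j → cancel (λ { refl → i≢j refl })) (divideOut (x zero) cs) λ i →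
    cancel {suc i} {zero} (λ ()) _ (subst (m ∣ℤ_) (eval-divideOut (x (suc i)) (x zero) cs)
      (∣m∣n⇒∣m-n (zeros (suc i)) (zeros zero))))

-- A divisor of N is invertible modulo N + 1.
divisor-cancellable : ∀ {δ} N → δ ∣ℤ + N → Cancellable (+ suc N) δ
divisor-cancellable {δ} N (divides u N≡uδ) y m∣δy = subst (+ suc N ∣ℤ_) eq
  (∣m∣n⇒∣m-n (divides y (ℤₚ.*-comm (+ suc N) y)) (∣n⇒∣m*n u m∣δy))
  where
  open ≡-Reasoning
  regroup : ∀ N y → (+ 1 ℤ.+ N) ℤ.* y ℤ.- N ℤ.* y ≡ y
  regroup = solveℤ-∀
  eq : + suc N ℤ.* y ℤ.- u ℤ.* (δ ℤ.* y) ≡ y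
  eq = begin
    + suc N ℤ.* y ℤ.- u ℤ.* (δ ℤ.* y)   ≡⟨ cong (λ t → + suc N ℤ.* y ℤ.- t) (trans (sym (ℤₚ.*-assoc u δ y)) (cong (ℤ._* y) (sym N≡uδ))) ⟩
    + suc N ℤ.* y ℤ.- + N ℤ.* y         ≡⟨ regroup (+ N) y ⟩
    y ∎

∣i-j∣≡∣i⊖j∣ : ∀ i j → ℤ.∣ + i ℤ.- + j ∣ ≡ ℤ.∣ i ℤ.⊖ j ∣
∣i-j∣≡∣i⊖j∣ i j = cong ℤ.∣_∣ (ℤₚ.[+m]-[+n]≡m⊖n i j)

∣i-j∣≤ : ∀ {i j b} → i ≤ b → j ≤ b → ℤ.∣ + i ℤ.- + j ∣ ≤ b
∣i-j∣≤ {i} {j} i≤b j≤b = subst (_≤ _) (sym (∣i-j∣≡∣i⊖j∣ i j)) (≤-trans (ℤₚ.∣m⊝n∣≤m⊔n i j) (⊔-lub i≤b j≤b))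

∣i-j∣≡0⇒i≡j : ∀ {i j} → ℤ.∣ + i ℤ.- + j ∣ ≡ 0 → i ≡ j
∣i-j∣≡0⇒i≡j {i} {j} eq = ℤₚ.+-injective (ℤₚ.i-j≡0⇒i≡j (+ i) (+ j) (ℤₚ.∣i∣≡0⇒i≡0 eq))

-- The absolute difference is between 1 and `v`, so it is a factor of `v !`.
difference∣factorial : ∀ {i j v} → i ≢ j → i ≤ v → j ≤ v → (+ i ℤ.- + j) ∣ℤ + (v !)
difference∣factorial {i} {j} {v} i≢j i≤v j≤v = ∣ᵤ⇒∣ (∣.∣-trans (n∣n! _ (λ z → i≢j (∣i-j∣≡0⇒i≡j z))) (∣.m≤n⇒m!∣n! (∣i-j∣≤ i≤v j≤v)))
  where
  n∣n! : ∀ n → n ≢ 0 → n ∣.∣ n !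
  n∣n! zero    0≢0 = ⊥-elim (0≢0 refl)
  n∣n! (suc n) _   = ∣.m∣m*n (n !)

congruent⇒≡ : ∀ {m i j} → i < suc m → j < suc m → + suc m ∣ℤ (+ i ℤ.- + j) → i ≡ j
congruent⇒≡ {m} {i} {j} (s≤s i≤m) (s≤s j≤m) div = ∣i-j∣≡0⇒i≡j (small (∣⇒∣ᵤ div) (∣i-j∣≤ i≤m j≤m))
  where
  small : ∀ {d} → suc m ∣.∣ d → d ≤ m → d ≡ 0
  small {zero}  _ _   = refl
  small {suc d} q d≤m = ⊥-elim (<⇒≱ (s≤s d≤m) (∣.∣⇒≤ q))

residue≡⇒∣ : ∀ m a b → a ℤ-DivMod.%ℕ suc m ≡ b ℤ-DivMod.%ℕ suc m → + suc m ∣ℤ (a ℤ.- b)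
residue≡⇒∣ m a b eq = divides (quot a ℤ.- quot b) (begin
  a ℤ.- b                                                          ≡⟨ cong₂ ℤ._-_ (ℤ-DivMod.a≡a%ℕn+[a/ℕn]*n a (suc m)) (ℤ-DivMod.a≡a%ℕn+[a/ℕn]*n b (suc m)) ⟩
  (+ (a ℤ-DivMod.%ℕ suc m) ℤ.+ quot a ℤ.* + suc m) ℤ.- (+ (b ℤ-DivMod.%ℕ suc m) ℤ.+ quot b ℤ.* + suc m)
                                                                   ≡⟨ cong (λ t → (+ t ℤ.+ quot a ℤ.* + suc m) ℤ.- (+ (b ℤ-DivMod.%ℕ suc m) ℤ.+ quot b ℤ.* + suc m)) eq ⟩
  (+ (b ℤ-DivMod.%ℕ suc m) ℤ.+ quot a ℤ.* + suc m) ℤ.- (+ (b ℤ-DivMod.%ℕ suc m) ℤ.+ quot b ℤ.* + suc m)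
                                           ≡⟨ regroup (+ (b ℤ-DivMod.%ℕ suc m)) (quot a) (quot b) (+ suc m) ⟩
  (quot a ℤ.- quot b) ℤ.* + suc m                                        ∎)
  where
  open ≡-Reasoning
  quot : ℤ → ℤ
  quot x = x ℤ-DivMod./ℕ suc m
  regroup : ∀ r x y m → (r ℤ.+ x ℤ.* m) ℤ.- (r ℤ.+ y ℤ.* m) ≡ (x ℤ.- y) ℤ.* m
  regroup = solveℤ-∀

funToFin-cong : ∀ {k m} {f g : Fin k → Fin m} → (∀ i → f i ≡ g i) → funToFin f ≡ funToFin g
funToFin-cong {zero}  eq = refl
funToFin-cong {suc k} eq = cong₂ combine (eq zero) (funToFin-cong (eq ∘ suc))

finToFun-injective : ∀ {k m} (a b : Fin (m ^ k)) → (∀ i → finToFun {m} {k} a i ≡ finToFun b i) → a ≡ b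
finToFun-injective {k} {m} a b eq =
  trans (sym (funToFin-finToFin {k} {m} a)) (trans (funToFin-cong eq) (funToFin-finToFin {k} {m} b))

-- The copies sit in the vertex set Fin v × ℤ/(1 + v! a) as the graphs of the polynomials of degree < k.
module PolynomialPacking {k v : ℕ} (F : Hypergraph k v) (v₀ : Fin v) (a n : ℕ) (fits : v * suc (v ! * a) ≤ n) where

  private
    N m : ℕ
    N = v ! * a
    m = suc N

  coefficients : Fin (m ^ k) → Vec ℤ k
  coefficients c = Vec.tabulate (λ j → + toℕ (finToFun {m} {k} c j))

  value : Fin (m ^ k) → Fin v → Fin m
  value c i = fromℕ< (ℤ-DivMod.n%ℕd<d (eval (+ toℕ i) (coefficients c)) m)

  point : Fin v → Fin m → Fin n
  point i r = inject≤ (combine i r) fits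

  point-injective : ∀ {i j r s} → point i r ≡ point j s → i ≡ j × r ≡ s
  point-injective {i} {j} {r} {s} eq = combine-injective i r j s (inject≤-injective fits fits _ _ eq)

  graph : Fin (m ^ k) → Fin v → Fin n
  graph c i = point i (value c i)

  column : Fin n → Fin v
  column x with any? (λ i → any? (λ r → x ≟ᶠ point i r))
  ... | yes (i , _) = i
  -- Vertices outside the grid lie on no edge of the packing; they get a default column because a
  -- rainbow copy may use them for isolated vertices of `G`.
  ... | no _        = v₀

  column-point : ∀ i r → column (point i r) ≡ i
  column-point i r with any? (λ j → any? (λ s → point i r ≟ᶠ point j s))
  ... | yes (j , s , eq) = sym (proj₁ (point-injective eq))
  ... | no none          = ⊥-elim (none (i , r , refl))

  img-column-graph : ∀ c s → img column (img (graph c) s) ≡ s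
  img-column-graph c s = trans (img-∘ column (graph c) s)
    (trans (img-cong s (λ {i} _ → column-point i (value c i))) (img-id s))

  -- The difference of the two polynomials vanishes modulo `m` at the `k` elements of `s`, whose
  -- differences divide `v !` and so can be cancelled. All coefficients then agree modulo `m`, and
  -- they are residues below `m`.
  agree⇒≡ : ∀ {s} → ∣ s ∣ ≡ k → ∀ c d → (∀ {i} → i ∈ s → value c i ≡ value d i) → c ≡ d
  agree⇒≡ {s} refl c d agree with enumerate s
  ... | pts , refl-set = finToFun-injective {k} {m} c d λ j → toℕ-injective (congruent⇒≡ (toℕ<n (C j)) (toℕ<n (E j))
          (subst (+ m ∣ℤ_) (difference j) (vanishing⇒zero (+ m) x cancel Δ zeros j)))
    where
    C E : Fin k → Fin m
    C = finToFun {m} {k} c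
    E = finToFun {m} {k} d
    x : Fin k → ℤ
    x i = + toℕ (lookup pts i)
    Δ : Vec ℤ k
    Δ = Vec.zipWith ℤ._-_ (coefficients c) (coefficients d)
    difference : ∀ j → lookup Δ j ≡ + toℕ (C j) ℤ.- + toℕ (E j)
    difference j = trans (lookup-zipWith ℤ._-_ j (coefficients c) (coefficients d))
      (cong₂ ℤ._-_ (lookup∘tabulate (λ j → + toℕ (C j)) j) (lookup∘tabulate (λ j → + toℕ (E j)) j))
    pts-injective : Injective _≡_ _≡_ (lookup pts)
    pts-injective = vset⇒injective pts (≤-reflexive (cong ∣_∣ (sym refl-set)))
    cancel : ∀ {i j} → i ≢ j → Cancellable (+ m) (x i ℤ.- x j)
    cancel {i} {j} i≢j = divisor-cancellable N (subst (x i ℤ.- x j ∣ℤ_) (sym (ℤₚ.pos-* (v !) a))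
      (∣m⇒∣m*n (+ a) (difference∣factorial (λ eq → i≢j (pts-injective (toℕ-injective eq)))
        (<⇒≤ (toℕ<n (lookup pts i))) (<⇒≤ (toℕ<n (lookup pts j))))))
    zeros : ∀ i → + m ∣ℤ eval (x i) Δ
    zeros i = subst (+ m ∣ℤ_) (sym (eval-zipWith-- (x i) (coefficients c) (coefficients d)))
      (residue≡⇒∣ N (eval (x i) (coefficients c)) (eval (x i) (coefficients d))
        (trans (sym (toℕ-fromℕ< _)) (trans (cong toℕ (agree (subst (lookup pts i ∈_) refl-set (∈-img⁺ (lookup pts) ∈⊤)))) (toℕ-fromℕ< _))))

  packing : Packing F n
  packing .count    = m ^ k
  packing .copy     = graph
  packing .copyInj c eq = proj₁ (point-injective eq)
  -- Projecting a common edge to the columns shows that it comes from the same edge of `F` in both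
  -- copies; the two polynomials then agree on that edge.
  packing .disjoint c d c≢d {s} {t} s∈ t∈ eq with s≡t
    where
    s≡t : s ≡ t
    s≡t = trans (sym (img-column-graph c s)) (trans (cong (img column) eq) (img-column-graph d t))
  ... | refl = c≢d (agree⇒≡ (All.lookup (uniform F) s∈) c d agree)
    where
    agree : ∀ {i} → i ∈ s → value c i ≡ value d i
    agree {i} i∈ with ∈-img⁻ (graph d) s (subst (graph c i ∈_) eq (∈-img⁺ (graph c) i∈))
    ... | w , _ , same with point-injective same
    ...   | refl , value≡ = value≡

  packing-rainbow-free : ∀ {vG} (G : Hypergraph k vG) → ¬ Hom G F → ¬ Rainbow G packing
  packing-rainbow-free G ¬hom rainbow = ¬hom (column ∘ ψ , All.tabulate edge)
    where
    open Rainbow rainbow renaming (fits to coloured)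
    edge : ∀ {s} → s LM.∈ edges G → img (column ∘ ψ) s LM.∈ edges F
    edge s∈ with coloured (Any.index s∈)
    ... | t , t∈ , eq = subst (LM._∈ edges F) (sym (begin
      img (column ∘ ψ) _                               ≡⟨ sym (img-∘ column ψ _) ⟩
      img column (img ψ _)                             ≡⟨ cong (img column ∘ img ψ) (Anyₚ.lookup-index s∈) ⟩
      img column (img ψ (List.lookup (edges G) (Any.index s∈)))  ≡⟨ cong (img column) eq ⟩
      img column (img (graph (col (Any.index s∈))) t)  ≡⟨ img-column-graph (col (Any.index s∈)) t ⟩
      t                                                ∎)) t∈
      where open ≡-Reasoning

-- The asymptotic bounds

-- The inequality n^k - A^k ≤ kq n^(k-1), multiplied by `n` and freed of subtraction.
nearby-powers : ∀ {A n} q k → A ≤ n → n ≤ A + q → n * n ^ k ≤ n * A ^ k + k * q * n ^ k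
nearby-powers {A} {n} q zero    A≤n n≤A+q = m≤m+n (n * 1) 0
nearby-powers {A} {n} q (suc k) A≤n n≤A+q = begin
  n * (n * n ^ k)                                          ≤⟨ *-monoʳ-≤ n (nearby-powers q k A≤n n≤A+q) ⟩
  n * (n * A ^ k + k * q * n ^ k)                          ≤⟨ *-monoʳ-≤ n (+-monoˡ-≤ _ (*-monoˡ-≤ (A ^ k) n≤A+q)) ⟩
  n * ((A + q) * A ^ k + k * q * n ^ k)                    ≡⟨ expand n A q (A ^ k) k (n ^ k) ⟩
  n * (A * A ^ k) + (q * (n * A ^ k) + k * q * (n * n ^ k)) ≤⟨ +-monoʳ-≤ (n * (A * A ^ k)) (+-monoˡ-≤ (k * q * (n * n ^ k)) (*-monoʳ-≤ q (*-monoʳ-≤ n (^-monoˡ-≤ k A≤n)))) ⟩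
  n * (A * A ^ k) + (q * (n * n ^ k) + k * q * (n * n ^ k)) ≡⟨ cong (λ t → n * (A * A ^ k) + t) (sym (trans (cong (_* (n * n ^ k)) (*-distribʳ-+ q 1 k)) (collect q k (n * n ^ k)))) ⟩
  n * (A * A ^ k) + suc k * q * (n * n ^ k)                ∎
  where
  open ≤-Reasoning
  expand : ∀ n A q x k y → n * ((A + q) * x + k * q * y) ≡ n * (A * x) + (q * (n * x) + k * q * (n * y))
  expand = solve-∀
  collect : ∀ q k y → (1 * q + k * q) * y ≡ q * y + k * q * y
  collect = solve-∀

^-distribʳ-* : ∀ k a b → (a * b) ^ k ≡ a ^ k * b ^ k
^-distribʳ-* zero    a b = refl
^-distribʳ-* (suc k) a b = trans (cong (a * b *_) (^-distribʳ-* k a b)) (interchange a b (a ^ k) (b ^ k))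
  where
  interchange : ∀ a b x y → a * b * (x * y) ≡ a * x * (b * y)
  interchange = solve-∀

-- The existence of the maximum forces an edge. If `F` had none, a rainbow copy could exist only for
-- an edgeless `G`, and then any map would be a homomorphism to `F`; so packings of any size would
-- be rainbow-free.
edges-nonempty : ∀ {k vF vG} (F : Hypergraph k vF) (G : Hypergraph k vG) → ¬ Hom G F → ∀ {m} → IsExF F G vF m → 1 ≤ e F
edges-nonempty {vF = vF} F G ¬hom {m} (_ , maximal) = nonempty (edges F) refl
  where
  -- Without edges, arbitrarily many identity copies are vacuously edge-disjoint.
  many : edges F ≡ [] → Packing F vF
  many noEdges = record { count = suc m ; copy = λ _ → id ; copyInj = λ _ → id ; disjoint = vacuous }
    where
    vacuous : ∀ i j → i ≢ j → ∀ {s t} → s LM.∈ edges F → t LM.∈ edges F → img id s ≢ img id t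
    vacuous i j i≢j s∈ with subst (_ LM.∈_) noEdges s∈
    ... | ()
  rainbow-free : ∀ noEdges → ¬ Rainbow G (many noEdges)
  -- The number of vertices is `vF` here, so `ψ` is itself a map from the vertices of `G` to those
  -- of `F`.
  rainbow-free noEdges rainbow = ¬hom (ψ , All.tabulate edge)
    where
    open Rainbow rainbow
    edge : ∀ {s} → s LM.∈ edges G → img ψ s LM.∈ edges F
    edge s∈ with fits (Any.index s∈)
    ... | t , t∈ , _ with subst (t LM.∈_) noEdges t∈
    ...   | ()
  nonempty : ∀ es → edges F ≡ es → 1 ≤ length es
  nonempty (_ ∷ _) _       = s≤s z≤n
  nonempty []      noEdges = ⊥-elim (<-irrefl refl (maximal (suc m) (many noEdges , refl , rainbow-free noEdges)))

vertex : ∀ {k v} (F : Hypergraph k v) → 1 ≤ k → 1 ≤ e F → Fin v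
vertex {v = suc v} F 1≤k 1≤e = zero
vertex {v = zero}  F 1≤k 1≤e = ⊥-elim (<⇒≱ 1≤k (noVertices (edges F) (uniform F) 1≤e))
  where
  noVertices : ∀ {k} (es : List (Subset 0)) → All (λ s → ∣ s ∣ ≡ k) es → 1 ≤ length es → k ≤ 0
  noVertices ([] ∷ es) (refl ∷ _) _ = z≤n

-- The polynomial packing fills `L` of the `n` vertices and has `(L / v) ^ k` copies. The at most
-- `q` vertices left over cost a term of order n^(k-1), absorbed once `n` is at least
-- `suc m * (k * q)`.
lower-bound : ∀ {k v vG} (F : Hypergraph k v) (G : Hypergraph k vG) → Fin v → ¬ Hom G F →
  (exF : ℕ → ℕ) → (∀ n → IsExF F G n (exF n)) →
  ∀ m → Eventually (λ n → suc m * n ^ k ≤ suc m * v ^ k * exF n + v ^ k * n ^ k)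
lower-bound {k} {v} F G v₀ ¬hom exF isExF m = suc (v + suc m * (k * q)) , bound
  where
  q = v * v !
  instance
    v≢0 : NonZero v
    v≢0 = >-nonZero (≤-trans (s≤s z≤n) (toℕ<n v₀))
    q≢0 : NonZero q
    q≢0 = m*n≢0 v (v !) {{v≢0}} {{v !≢0}}
  bound : ∀ n → suc (v + suc m * (k * q)) ≤ n → suc m * n ^ k ≤ suc m * v ^ k * exF n + v ^ k * n ^ k
  bound n large = *-cancelˡ-≤-pos 1≤n (begin
    n * (suc m * n ^ k)                                      ≡⟨ regroup n (suc m) (n ^ k) ⟩
    suc m * (n * n ^ k)                                      ≤⟨ *-monoʳ-≤ (suc m) (nearby-powers q k L≤n n≤L+q) ⟩
    suc m * (n * L ^ k + k * q * n ^ k)                      ≡⟨ regroup′ (suc m) n (L ^ k) (k * q) (n ^ k) ⟩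
    n * (suc m * L ^ k) + suc m * (k * q) * n ^ k            ≤⟨ +-mono-≤ (*-monoʳ-≤ n (*-monoʳ-≤ (suc m) L^k≤)) (*-mono-≤ m[kq]≤n n^k≤) ⟩
    n * (suc m * (v ^ k * exF n)) + n * (v ^ k * n ^ k)      ≡⟨ regroup″ n (suc m) (v ^ k) (exF n) (n ^ k) ⟩
    n * (suc m * v ^ k * exF n + v ^ k * n ^ k)              ∎)
    where
    open ≤-Reasoning
    1≤n : 1 ≤ n
    1≤n = ≤-trans (s≤s z≤n) large
    v≤n : v ≤ n
    v≤n = ≤-trans (m≤m+n v _) (≤-trans (n≤1+n _) large)
    m[kq]≤n : suc m * (k * q) ≤ n
    m[kq]≤n = ≤-trans (m≤n+m _ v) (≤-trans (n≤1+n _) large)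
    -- The grid sizes are `v + a * q`; this is the largest `a` for which the grid fits into `n`
    -- vertices.
    a = (n ∸ v) / q
    L = v * suc (v ! * a)
    L≡ : L ≡ v + a * q
    L≡ = unfold v (v !) a
      where
      unfold : ∀ v f a → v * suc (f * a) ≡ v + a * (v * f)
      unfold = solve-∀
    L≤n : L ≤ n
    L≤n = begin
      L            ≡⟨ L≡ ⟩
      v + a * q    ≤⟨ +-monoʳ-≤ v (m/n*n≤m (n ∸ v) q) ⟩
      v + (n ∸ v)  ≡⟨ m+[n∸m]≡n v≤n ⟩
      n            ∎
    n≤L+q : n ≤ L + q
    n≤L+q = begin
      n                           ≡⟨ sym (m+[n∸m]≡n v≤n) ⟩
      v + (n ∸ v)                 ≡⟨ cong (λ t → v + t) (m≡m%n+[m/n]*n (n ∸ v) q) ⟩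
      v + ((n ∸ v) % q + a * q)   ≤⟨ +-monoʳ-≤ v (+-monoˡ-≤ (a * q) (<⇒≤ (m%n<n (n ∸ v) q))) ⟩
      v + (q + a * q)             ≡⟨ trans (cong (λ t → v + t) (+-comm q (a * q))) (trans (sym (+-assoc v (a * q) q)) (cong (_+ q) (sym L≡))) ⟩
      L + q                       ∎
    open PolynomialPacking F v₀ a n L≤n
    L^k≤ : L ^ k ≤ v ^ k * exF n
    L^k≤ = begin
      L ^ k                        ≡⟨ ^-distribʳ-* k v (suc (v ! * a)) ⟩
      v ^ k * suc (v ! * a) ^ k    ≤⟨ *-monoʳ-≤ (v ^ k) (proj₂ (isExF n) _ (packing , refl , packing-rainbow-free G ¬hom)) ⟩
      v ^ k * exF n                ∎
    n^k≤ : n ^ k ≤ v ^ k * n ^ k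
    n^k≤ = m≤n*m (n ^ k) (v ^ k) {{m^n≢0 v k}}
    regroup : ∀ n m x → n * (m * x) ≡ m * (n * x)
    regroup = solve-∀
    regroup′ : ∀ m n x c y → m * (n * x + c * y) ≡ n * (m * x) + m * c * y
    regroup′ = solve-∀
    regroup″ : ∀ n m x y z → n * (m * (x * y)) + n * (x * z) ≡ n * (m * x * y + x * z)
    regroup″ = solve-∀

upper-bound : ∀ {k vF vG} (F : Hypergraph k vF) (G : Hypergraph k vG) → 1 ≤ e F →
  (exF exK : ℕ → ℕ) → (∀ n → IsExF F G n (exF n)) → (∀ n → IsExK G n (exK n)) →
  ∀ m → Eventually (λ n → suc m * e F * exF n ≤ suc m * exK n + e F * n ^ k)
upper-bound {k} {vF} {vG} F G 1≤eF exF exK isExF isExK m = M + C * p ^ (2 ^ vG) , bound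
  where
  μ = suc m
  -- Blocks of size about `n / M` make the share of folded tuples at most `1 / (2 * μ)`.
  M = suc (4 * (μ * (k * k)))
  T = M ^ vG
  -- The bad samples then have share at most `T / p`, which is the other `1 / (2 * μ)`.
  p = 2 * (μ * T)
  C = (vG * vG + e G * vG) * suc vF
  bound : ∀ n → M + C * p ^ (2 ^ vG) ≤ n → μ * e F * exF n ≤ μ * exK n + e F * n ^ k
  bound n large with isExF n
  ... | (R , count≡exF , ¬rainbow) , _ = begin
    μ * e F * exF n            ≡⟨ regroup μ (e F) (exF n) ⟩
    μ * (exF n * e F)          ≡⟨ cong (μ *_) (sym (trans (e-union R) (cong (_* e F) count≡exF))) ⟩
    μ * E                      ≤⟨ *-cancelˡ-≤-pos (*-mono-≤ (*-mono-≤ (s≤s {n = 1} z≤n) 1≤n) (m^n>0 M vG)) final ⟩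
    μ * exK n + K              ≤⟨ +-monoʳ-≤ (μ * exK n) (m≤n*m K (e F) {{>-nonZero 1≤eF}}) ⟩
    μ * exK n + e F * K        ∎
    where
    open ≤-Reasoning
    K = n ^ k
    E = e (union R)
    M≤n : M ≤ n
    M≤n = ≤-trans (m≤m+n M _) large
    1≤n : 1 ≤ n
    1≤n = ≤-trans (s≤s z≤n) M≤n
    -- Rounding up ensures that `M` blocks cover all vertices; since `M ≤ n`, still `M * q ≤ 2 * n`.
    q = suc (n / M)
    Mq≡ : M * q ≡ M + n / M * M
    Mq≡ = *-comm M q
    covers : n ≤ M * q
    covers = begin
      n                        ≡⟨ m≡m%n+[m/n]*n n M ⟩
      n % M + n / M * M        ≤⟨ +-monoˡ-≤ (n / M * M) (<⇒≤ (m%n<n n M)) ⟩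
      M + n / M * M            ≡⟨ sym Mq≡ ⟩
      M * q                    ∎
    2μk²q≤n : 2 * (μ * (k * k * q)) ≤ n
    2μk²q≤n = *-cancelˡ-≤ 2 (begin
      2 * (2 * (μ * (k * k * q)))   ≡⟨ quadruple μ k q ⟩
      4 * (μ * (k * k)) * q         ≤⟨ *-monoˡ-≤ q (n≤1+n (4 * (μ * (k * k)))) ⟩
      M * q                         ≡⟨ Mq≡ ⟩
      M + n / M * M                 ≤⟨ +-mono-≤ M≤n (m/n*n≤m n M) ⟩
      n + n                         ≡⟨ cong (λ t → n + t) (sym (+-identityʳ n)) ⟩
      2 * n                         ∎)
      where
      quadruple : ∀ μ k q → 2 * (2 * (μ * (k * k * q))) ≡ 4 * (μ * (k * k)) * q
      quadruple = solve-∀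
    open Blocks n M q covers
    open Sampling G (union R) 1≤n block q block-fibre p
      (λ φ → few-injective⇒few G (union R) 1≤n φ p C (rainbow-free⇒few-homs R G M ¬rainbow) (≤-trans (m≤n+m _ M) large))
      (exK n) (λ H′ free → proj₂ (isExK n) (e H′) (H′ , refl , free))
    final : 2 * n * T * (μ * E) ≤ 2 * n * T * (μ * exK n + K)
    final = begin
      2 * n * T * (μ * E)                                          ≡⟨ lhs n T μ E ⟩
      n * (p * E)                                                  ≤⟨ sampled-bound ⟩
      n * (p * exK n) + n * (T * K) + p * (k * k * q) * K          ≡⟨ mid n T μ (exK n) K (k * k * q) ⟩
      n * (p * exK n) + n * (T * K) + 2 * (μ * (k * k * q)) * (T * K)
                                                                   ≤⟨ +-monoʳ-≤ (n * (p * exK n) + n * (T * K)) (*-monoˡ-≤ (T * K) 2μk²q≤n) ⟩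
      n * (p * exK n) + n * (T * K) + n * (T * K)                  ≡⟨ rhs n T μ (exK n) K ⟩
      2 * n * T * (μ * exK n + K)                                  ∎
      where
      lhs : ∀ n T μ E → 2 * n * T * (μ * E) ≡ n * (2 * (μ * T) * E)
      lhs = solve-∀
      mid : ∀ n T μ X K c → n * (2 * (μ * T) * X) + n * (T * K) + 2 * (μ * T) * c * K ≡
            n * (2 * (μ * T) * X) + n * (T * K) + 2 * (μ * c) * (T * K)
      mid = solve-∀
      rhs : ∀ n T μ X K → n * (2 * (μ * T) * X) + n * (T * K) + n * (T * K) ≡ 2 * n * T * (μ * X + K)
      rhs = solve-∀
    regroup : ∀ a b c → a * b * c ≡ a * (c * b)
    regroup = solve-∀

-- Greedy removal in an extremal `G`-free hypergraph leaves an `F`-free rest with at most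
-- `n ^ k / suc m` edges. The packing is rainbow-free since its union lies in a `G`-free hypergraph.
partite-lower-bound : ∀ {k vF vG} (F : Hypergraph k vF) (G : Hypergraph k vG) → 1 ≤ e F → KPartite F →
  (exF exK : ℕ → ℕ) → (∀ n → IsExF F G n (exF n)) → (∀ n → IsExK G n (exK n)) →
  ∀ m → Eventually (λ n → suc m * exK n ≤ suc m * e F * exF n + e F * n ^ k)
partite-lower-bound {k} {vF} F G 1≤eF (c , partite) exF exK isExF isExK m =
  suc (vF * vF * suc m ^ (2 ^ vF)) , bound
  where
  bound : ∀ n → suc (vF * vF * suc m ^ (2 ^ vF)) ≤ n → suc m * exK n ≤ suc m * e F * exF n + e F * n ^ k
  bound n large with isExK n
  ... | (H , eH≡exK , free) , _ with greedy F (suc m) (n ^ k) 1≤eF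
         (λ H′ F-free → partite-density F H′ c partite (suc m) F-free (≤-trans (s≤s z≤n) large) (≤-trans (n≤1+n _) large))
         (e H) H ≤-refl
  ...   | R , within , packed = begin
    suc m * exK n                            ≡⟨ cong (suc m *_) (sym eH≡exK) ⟩
    suc m * e H                              ≤⟨ packed ⟩
    suc m * (count R * e F) + n ^ k          ≤⟨ +-mono-≤ (*-monoʳ-≤ (suc m) (*-monoˡ-≤ (e F)
                                                  (proj₂ (isExF n) (count R) (R , refl , within-free⇒rainbow-free G H R within free))))
                                                  (m≤n*m (n ^ k) (e F) {{>-nonZero 1≤eF}}) ⟩
    suc m * (exF n * e F) + e F * n ^ k      ≡⟨ cong (λ t → t + e F * n ^ k) (regroup (suc m) (exF n) (e F)) ⟩
    suc m * e F * exF n + e F * n ^ k        ∎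
    where
    open ≤-Reasoning
    regroup : ∀ a b c → a * (b * c) ≡ a * c * b
    regroup = solve-∀

-- An error term o(n^k) is expressed by the bound `n ^ k / suc m`, valid for every `m` and all large
-- `n`, with denominators cleared. For `k`-partite `F` the equality consists of the upper bound,
-- which holds in general, and the reverse inequality in the last component.
theorem1p13 : (k : ℕ) → 2 ≤ k → {vF vG : ℕ} (F : Hypergraph k vF) (G : Hypergraph k vG) →
    ¬ Hom G F →
    (exF exK : ℕ → ℕ) → (∀ n → IsExF F G n (exF n)) → (∀ n → IsExK G n (exK n)) →
    ((∀ m → Eventually (λ n → suc m * n ^ k ≤ suc m * vF ^ k * exF n + vF ^ k * n ^ k)) ×
    (∀ m → Eventually (λ n → suc m * e F * exF n ≤ suc m * exK n + e F * n ^ k))) ×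
    (KPartite F →
    ∀ m → Eventually (λ n → suc m * exK n ≤ suc m * e F * exF n + e F * n ^ k))
theorem1p13 k 2≤k {vF} F G ¬hom exF exK isExF isExK =
  (lower-bound F G (vertex F (≤-trans (s≤s z≤n) 2≤k) 1≤eF) ¬hom exF isExF ,
   upper-bound F G 1≤eF exF exK isExF isExK) ,
  λ partite → partite-lower-bound F G 1≤eF partite exF exK isExF isExK
  where
  1≤eF : 1 ≤ e F
  1≤eF = edges-nonempty F G ¬hom (isExF vF)
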